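{- Let $(X_n)$ be a sequence of finite sets and let $(\mathcal{F}_n)$ be a sequence of nontrivial upper sets $\mathcal{F}_n \subseteq 2^{X_n}$. Let $K>0$ be a constant such that $p_c(\mathcal{F}_n)\leq K q(\mathcal{F}_n)\log \ell(\mathcal{F}_n)$ for all $n$. (i) If $\dim(\mathcal{F}_n)>\frac12\big(K\log\ell(\mathcal{F}_n)\big)^{\ell(\mathcal{F}_n)}$ for all sufficiently large $n$, then the Kahn-Kalai bounds provide nontrivial information for $(\mathcal{F}_n)$. (ii) If $\log\ell(\mathcal{F}_n)\ll(2\dim(\mathcal{F}_n))^{1/\ell(\mathcal{F}_n)}$, then the Kahn-Kalai bounds provide asymptotically perfect information for $(\mathcal{F}_n)$.
   Context: For a finite set $X$, an upper set is a subset $\mathcal{F}\subseteq 2^X$ such that $A\in\mathcal{F}$ and $A\subseteq B\subseteq X$ imply $B\in\mathcal{F}$; it is nontrivial if $\mathcal{F}\neq\emptyset$ and $\mathcal{F}\neq 2^X$. For $p\in[0,1]$ let $\mu_p(\mathcal{F})=\sum_{S\in\mathcal{F}}p^{|S|}(1-p)^{|X|-|S|}$; for nontrivial $\mathcal{F}$, the critical probability $p_c(\mathcal{F})$ is the unique $p\in[0,1]$ with $\mu_p(\mathcal{F})=\frac12$. For $S\subseteq X$ let $\langle S\rangle=\{T\subseteq X: S\subseteq T\}$, and for $\mathcal{G}\subseteq 2^X$ let $\langle\mathcal{G}\rangle=\bigcup_{S\in\mathcal{G}}\langle S\rangle$. A set $\mathcal{G}\subseteq 2^X$ is a cover of $\mathcal{F}$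 if $\mathcal{F}\subseteq\langle\mathcal{G}\rangle$. $\mathcal{F}$ is $p$-small if it has a cover $\mathcal{G}$ with $\sum_{S\in\mathcal{G}}p^{|S|}\leq\frac12$. The expectation threshold $q(\mathcal{F})$ is the largest $p\in[0,1]$ for which $\mathcal{F}$ is $p$-small. The covering dimension is $\dim(\mathcal{F})=\min\{|\mathcal{G}|:\mathcal{G}\subseteq2^X,\ \mathcal{F}\subseteq\langle\mathcal{G}\rangle\neq2^X\}$. $\mathcal{F}_0$ denotes the set of (inclusion-)minimal elements of $\mathcal{F}$, $\ell_0(\mathcal{F})=\max\{|S|:S\in\mathcal{F}_0\}$ and $\ell(\mathcal{F})=\max\{\ell_0(\mathcal{F}),2\}$. $\log$ is the logarithm to base 2. For positive sequences, $a_n\ll b_n$ means $a_n/b_n\to0$. The Kahn-Kalai bounds $q(\mathcal{F}_n)\leq p_c(\mathcal{F}_n)\leq Kq(\mathcal{F}_n)\log\ell(\mathcal{F}_n)$ provide nontrivial information for $(\mathcal{F}_n)$ if there exists $N$ such that $Kq(\mathcal{F}_n)\log\ell(\mathcal{F}_n)<1$ for all $n\geq N$; they provide asymptotically perfect information if $\lim_{n\to\infty}(K\log\ell(\mathcal{F}_n)-1)q(\mathcal{F}_n)=0$. -}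

module Defs where

open import Data.Bool.Base using (Bool; true; false; T)
open import Data.Empty using (⊥-elim)
open import Data.Fin.Subset using (Subset; inside; outside; _⊆_) renaming (∣_∣ to ∥_∥)
open import Data.Integer.Base as ℤ using (+_; +[1+_])
import Data.Integer.Properties as ℤ
import Data.Integer.Solver as ℤSolver
open import Data.List.Base as List using (List; _++_; filterᵇ; foldr; length)
open import Data.Nat.Base as ℕ using (ℕ; zero; suc; NonZero; _∸_; _⊔_)
open import Data.Nat.Induction using (<-rec)
open import Data.Nat.Logarithm
  using (⌊log₂_⌋; ⌊log₂⌋-mono-≤; ⌊log₂⌊n/2⌋⌋≡⌊log₂n⌋∸1; ⌊log₂[2^n]⌋≡n)
import Data.Nat.Properties as ℕ
open import Data.Product.Base using (∃; ∃-syntax; _×_; _,_; proj₁; proj₂)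
open import Data.Rational.Base as ℚ using (ℚ; 0ℚ; 1ℚ; ½; mkℚ)
import Data.Rational.Properties as ℚ
open import Data.Rational.Solver using (module +-*-Solver)
import Data.Rational.Unnormalised.Base as ℚᵘ
import Data.Rational.Unnormalised.Properties as ℚᵘ
open import Data.Sum.Base using (inj₁; inj₂)
open import Data.Vec.Base using ([]; _∷_)
open import Relation.Binary.PropositionalEquality
  using (_≡_; _≢_; refl; sym; trans; cong; cong₂; subst)
open import Relation.Nullary using (¬_; yes; no)

neg-diff : ∀ a b → b ℚ.- a ≡ ℚ.- (a ℚ.- b)
neg-diff = solve 2 (λ a b → b :- a := :- (a :- b)) refl
  where open +-*-Solver

∣-∣-sym : ∀ p q → ℚ.∣ p ℚ.- q ∣ ≡ ℚ.∣ q ℚ.- p ∣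
∣-∣-sym p q = trans
  (cong ℚ.∣_∣ (neg-diff q p))
  (ℚ.∣-p∣≡∣p∣ (q ℚ.- p))

∣∣-bound : ∀ p {r} → p ℚ.< r → ℚ.- p ℚ.< r → ℚ.∣ p ∣ ℚ.< r
∣∣-bound p p<r -p<r with ℚ.∣p∣≡p∨∣p∣≡-p p
... | inj₁ eq = subst (ℚ._< _) (sym eq) p<r
... | inj₂ eq = subst (ℚ._< _) (sym eq) -p<r

≤+⇒-≤ : ∀ {p q r} → p ℚ.≤ r ℚ.+ q → p ℚ.- q ℚ.≤ r
≤+⇒-≤ {p} {q} {r} h = subst (p ℚ.- q ℚ.≤_)
  (solve 2 (λ r q → r :+ q :- q := r) refl r q) (ℚ.+-monoˡ-≤ (ℚ.- q) h)
  where open +-*-Solver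

∣p∣≤∣p-q∣+∣q∣ : ∀ p q → ℚ.∣ p ∣ ℚ.≤ ℚ.∣ p ℚ.- q ∣ ℚ.+ ℚ.∣ q ∣
∣p∣≤∣p-q∣+∣q∣ p q = subst (λ z → ℚ.∣ z ∣ ℚ.≤ ℚ.∣ p ℚ.- q ∣ ℚ.+ ℚ.∣ q ∣)
  (solve 2 (λ p q → p :- q :+ q := p) refl p q) (ℚ.∣p+q∣≤∣p∣+∣q∣ (p ℚ.- q) q)
  where open +-*-Solver

½ε+½ε≡ε : ∀ ε → ½ ℚ.* ε ℚ.+ ½ ℚ.* ε ≡ ε
½ε+½ε≡ε ε = trans (sym (ℚ.*-distribʳ-+ ε ½ ½)) (ℚ.*-identityˡ ε)

0<* : ∀ {p q} → 0ℚ ℚ.< p → 0ℚ ℚ.< q → 0ℚ ℚ.< p ℚ.* q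
0<* {p} {q} 0<p 0<q = ℚ.positive⁻¹ (p ℚ.* q)
  {{ℚ.pos*pos⇒pos p {{ℚ.positive 0<p}} q {{ℚ.positive 0<q}}}}

0<½* : ∀ {ε} → 0ℚ ℚ.< ε → 0ℚ ℚ.< ½ ℚ.* ε
0<½* = 0<* (ℚ.positive⁻¹ ½)

≤+pos : ∀ p ε → 0ℚ ℚ.< ε → p ℚ.≤ p ℚ.+ ε
≤+pos p ε 0<ε = ℚ.≤-trans (ℚ.≤-reflexive (sym (ℚ.+-identityʳ p))) (ℚ.+-monoʳ-≤ p (ℚ.<⇒≤ 0<ε))

-- 1 / p, with the value 0 at p = 0.
recip : ℚ → ℚ
recip p with p ℚ.≟ 0ℚ
... | yes _   = 0ℚ
... | no p≢0 = ℚ.1/_ p {{ℚ.≢-nonZero p≢0}}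

recip-inverse : ∀ {p} → 0ℚ ℚ.< p → recip p ℚ.* p ≡ 1ℚ
recip-inverse {p} 0<p with p ℚ.≟ 0ℚ
... | yes p≡0 = ⊥-elim (ℚ.<-irrefl (sym p≡0) 0<p)
... | no  p≢0 = ℚ.*-inverseˡ p {{ℚ.≢-nonZero p≢0}}

recip-pos : ∀ {p} → 0ℚ ℚ.< p → 0ℚ ℚ.< recip p
recip-pos {p} 0<p = ℚ.*-cancelʳ-<-nonNeg p {{ℚ.nonNegative (ℚ.<⇒≤ 0<p)}}
  (subst₂< (ℚ.*-zeroˡ p) (recip-inverse 0<p) (ℚ.positive⁻¹ 1ℚ))
  where
  subst₂< : ∀ {a b c d} → a ≡ b → c ≡ d → b ℚ.< d → a ℚ.< c
  subst₂< refl refl h = h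

sum-diff : ∀ a b c d → (a ℚ.+ b) ℚ.- (c ℚ.+ d) ≡ (a ℚ.- c) ℚ.+ (b ℚ.- d)
sum-diff = solve 4 (λ a b c d → (a :+ b) :- (c :+ d) := (a :- c) :+ (b :- d)) refl
  where open +-*-Solver

product-diff : ∀ a b c d → a ℚ.* b ℚ.- c ℚ.* d ≡ a ℚ.* (b ℚ.- d) ℚ.+ d ℚ.* (a ℚ.- c)
product-diff = solve 4 (λ a b c d → a :* b :- c :* d := a :* (b :- d) :+ d :* (a :- c)) refl
  where open +-*-Solver

diff-product : ∀ r s a b →
  (r ℚ.- s) ℚ.* (a ℚ.* b) ≡ (r ℚ.* a) ℚ.* b ℚ.- (s ℚ.* b) ℚ.* a
diff-product = solve 4 (λ r s a b → (r :- s) :* (a :* b) := (r :* a) :* b :- (s :* b) :* a) refl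
  where open +-*-Solver

-- If ∣u∣ ≤ B and ∣v∣ < e / B, then ∣u∣∣v∣ < e.
*-small : ∀ {B u v e} → 0ℚ ℚ.< B → ℚ.∣ u ∣ ℚ.≤ B →
  ℚ.∣ v ∣ ℚ.< e ℚ.* recip B → ℚ.∣ u ∣ ℚ.* ℚ.∣ v ∣ ℚ.< e
*-small {B} {u} {v} {e} 0<B u≤B v<δ = begin-strict
  ℚ.∣ u ∣ ℚ.* ℚ.∣ v ∣
    ≤⟨ ℚ.*-monoʳ-≤-nonNeg ℚ.∣ v ∣ {{ℚ.∣-∣-nonNeg v}} u≤B ⟩
  B ℚ.* ℚ.∣ v ∣
    <⟨ ℚ.*-monoʳ-<-pos B {{ℚ.positive 0<B}} v<δ ⟩
  B ℚ.* (e ℚ.* recip B)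
    ≡⟨ rearrange B e (recip B) ⟩
  e ℚ.* (recip B ℚ.* B)
    ≡⟨ cong (e ℚ.*_) (recip-inverse 0<B) ⟩
  e ℚ.* 1ℚ
    ≡⟨ ℚ.*-identityʳ e ⟩
  e ∎
  where
  open ℚ.≤-Reasoning
  rearrange : ∀ b e r → b ℚ.* (e ℚ.* r) ≡ e ℚ.* (r ℚ.* b)
  rearrange = solve 3 (λ b e r → b :* (e :* r) := e :* (r :* b)) refl
    where open +-*-Solver

products-close : ∀ a b c d B C e → 0ℚ ℚ.< B → 0ℚ ℚ.< C →
  ℚ.∣ a ∣ ℚ.≤ B → ℚ.∣ d ∣ ℚ.≤ C →
  ℚ.∣ a ℚ.- c ∣ ℚ.< e ℚ.* recip C → ℚ.∣ b ℚ.- d ∣ ℚ.< e ℚ.* recip B →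
  ℚ.∣ a ℚ.* b ℚ.- c ℚ.* d ∣ ℚ.< e ℚ.+ e
products-close a b c d B C e 0<B 0<C a≤B d≤C h k = begin-strict
  ℚ.∣ a ℚ.* b ℚ.- c ℚ.* d ∣
    ≡⟨ cong ℚ.∣_∣ (product-diff a b c d) ⟩
  ℚ.∣ a ℚ.* (b ℚ.- d) ℚ.+ d ℚ.* (a ℚ.- c) ∣
    ≤⟨ ℚ.∣p+q∣≤∣p∣+∣q∣ (a ℚ.* (b ℚ.- d)) (d ℚ.* (a ℚ.- c)) ⟩
  ℚ.∣ a ℚ.* (b ℚ.- d) ∣ ℚ.+ ℚ.∣ d ℚ.* (a ℚ.- c) ∣
    ≡⟨ cong₂ ℚ._+_ (ℚ.∣p*q∣≡∣p∣*∣q∣ a (b ℚ.- d)) (ℚ.∣p*q∣≡∣p∣*∣q∣ d (a ℚ.- c)) ⟩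
  ℚ.∣ a ∣ ℚ.* ℚ.∣ b ℚ.- d ∣ ℚ.+ ℚ.∣ d ∣ ℚ.* ℚ.∣ a ℚ.- c ∣
    <⟨ ℚ.+-mono-< (*-small {B} {a} {b ℚ.- d} {e} 0<B a≤B k)
                  (*-small {C} {d} {a ℚ.- c} {e} 0<C d≤C h) ⟩
  e ℚ.+ e ∎
  where open ℚ.≤-Reasoning

fraction-≤ : ∀ {a b c d} → a ℕ.* suc d ℕ.≤ c ℕ.* suc b →
  + a ℚ./ suc b ℚ.≤ + c ℚ./ suc d
fraction-≤ {a} {b} {c} {d} h = ℚ.toℚᵘ-cancel-≤
  (ℚᵘ.≤-respˡ-≃ (ℚᵘ.≃-sym (ℚ.toℚᵘ-fromℚᵘ (ℚᵘ.mkℚᵘ (+ a) b)))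
  (ℚᵘ.≤-respʳ-≃ (ℚᵘ.≃-sym (ℚ.toℚᵘ-fromℚᵘ (ℚᵘ.mkℚᵘ (+ c) d)))
  (ℚᵘ.*≤* (subst₂≤ (ℤ.pos-* a (suc d)) (ℤ.pos-* c (suc b)) (ℤ.+≤+ h)))))
  where
  subst₂≤ : ∀ {i j k l} → i ≡ j → k ≡ l → i ℤ.≤ k → j ℤ.≤ l
  subst₂≤ refl refl h = h

fraction-suc : ∀ a b → + suc a ℚ./ suc b ℚ.≤ + a ℚ./ suc b ℚ.+ + 1 ℚ./ suc b
fraction-suc a b = ℚ.toℚᵘ-cancel-≤
  (ℚᵘ.≤-respˡ-≃ (ℚᵘ.≃-sym (ℚ.toℚᵘ-fromℚᵘ (ℚᵘ.mkℚᵘ (+ suc a) b)))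
  (ℚᵘ.≤-respʳ-≃ (ℚᵘ.≃-sym (ℚᵘ.≃-trans (ℚ.toℚᵘ-homo-+ (+ a ℚ./ suc b) (+ 1 ℚ./ suc b))
     (ℚᵘ.+-cong (ℚ.toℚᵘ-fromℚᵘ (ℚᵘ.mkℚᵘ (+ a) b)) (ℚ.toℚᵘ-fromℚᵘ (ℚᵘ.mkℚᵘ (+ 1) b)))))
  (ℚᵘ.≤-reflexive (ℚᵘ.*≡* eq))))
  where
  open ℤSolver.+-*-Solver
  eq : + suc a ℤ.* (+ suc b ℤ.* + suc b) ≡ (+ a ℤ.* + suc b ℤ.+ + 1 ℤ.* + suc b) ℤ.* + suc b
  eq = solve 2 (λ x y → (con (+ 1) :+ x) :* (y :* y) := (x :* y :+ con (+ 1) :* y) :* y)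
         refl (+ a) (+ suc b)

1/n-small : ∀ {ε} → 0ℚ ℚ.< ε → ∃[ N ] ∀ n → N ℕ.≤ n → + 1 ℚ./ suc n ℚ.< ε
1/n-small {mkℚ (+ zero) d c} 0<ε = ⊥-elim (¬pos (ℚ.positive 0<ε))
  where
  ¬pos : ¬ ℚ.Positive (mkℚ (+ zero) d c)
  ¬pos ()
1/n-small {mkℚ (ℤ.-[1+ k ]) d c} 0<ε = ⊥-elim (¬pos (ℚ.positive 0<ε))
  where
  ¬pos : ¬ ℚ.Positive (mkℚ (ℤ.-[1+ k ]) d c)
  ¬pos ()
1/n-small {mkℚ +[1+ k ] d c} _ = suc d , λ n d<n → ℚ.toℚᵘ-cancel-<
  (ℚᵘ.<-respˡ-≃ (ℚᵘ.≃-sym (ℚ.toℚᵘ-fromℚᵘ (ℚᵘ.mkℚᵘ (+ 1) n)))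
  (ℚᵘ.*<* (ℤ.+<+ (ℕ.≤-trans (ℕ.s≤s (ℕ.≤-trans (ℕ.≤-reflexive (ℕ.+-identityʳ (suc d))) d<n))
    (ℕ.m≤n*m (suc n) (suc k))))))

IsCauchy : (ℕ → ℚ) → Set
IsCauchy s = ∀ ε → 0ℚ ℚ.< ε →
  ∃[ N ] ∀ m n → N ℕ.≤ m → N ℕ.≤ n → ℚ.∣ s m ℚ.- s n ∣ ℚ.< ε

-- Reals are Cauchy sequences with an explicit modulus; the arithmetic is
-- pointwise and equality of reals is _≃_.
record ℝ : Set where
  constructor mkℝ
  field
    seq      : ℕ → ℚ
    isCauchy : IsCauchy seq

open ℝ public

infix  4 _≃_ _≤_ _<_ _⟶_
infixl 6 _+_ _-_
infixl 7 _*_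
infix  8 -_
infixr 8 _^_

_≃_ : ℝ → ℝ → Set
x ≃ y = ∀ ε → 0ℚ ℚ.< ε → ∃[ N ] ∀ n → N ℕ.≤ n → ℚ.∣ seq x n ℚ.- seq y n ∣ ℚ.< ε

_≤_ : ℝ → ℝ → Set
x ≤ y = ∀ ε → 0ℚ ℚ.< ε → ∃[ N ] ∀ n → N ℕ.≤ n → seq x n ℚ.≤ seq y n ℚ.+ ε

_<_ : ℝ → ℝ → Set
x < y = ∃[ ε ] 0ℚ ℚ.< ε × ∃[ N ] ∀ n → N ℕ.≤ n → seq x n ℚ.+ ε ℚ.≤ seq y n

fromℚ : ℚ → ℝ
fromℚ p = mkℝ (λ _ → p) λ ε 0<ε →
  0 , λ _ _ _ _ → subst (λ z → ℚ.∣ z ∣ ℚ.< ε) (sym (ℚ.+-inverseʳ p)) 0<ε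

fromℕ : ℕ → ℝ
fromℕ n = fromℚ (+ n ℚ./ 1)

0ℝ 1ℝ ½ℝ : ℝ
0ℝ = fromℚ 0ℚ
1ℝ = fromℚ 1ℚ
½ℝ = fromℚ ½

_+_ : ℝ → ℝ → ℝ
x + y = mkℝ (λ n → seq x n ℚ.+ seq y n) cauchy
  where
  cauchy : IsCauchy (λ n → seq x n ℚ.+ seq y n)
  cauchy ε 0<ε with isCauchy x (½ ℚ.* ε) (0<½* 0<ε) | isCauchy y (½ ℚ.* ε) (0<½* 0<ε)
  ... | N , hx | M , hy = N ⊔ M , λ m n p q →
    let open ℚ.≤-Reasoning
        a = seq x m ; b = seq y m ; c = seq x n ; d = seq y n
    in begin-strict
      ℚ.∣ (a ℚ.+ b) ℚ.- (c ℚ.+ d) ∣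
        ≡⟨ cong ℚ.∣_∣ (sum-diff a b c d) ⟩
      ℚ.∣ (a ℚ.- c) ℚ.+ (b ℚ.- d) ∣
        ≤⟨ ℚ.∣p+q∣≤∣p∣+∣q∣ (a ℚ.- c) (b ℚ.- d) ⟩
      ℚ.∣ a ℚ.- c ∣ ℚ.+ ℚ.∣ b ℚ.- d ∣
        <⟨ ℚ.+-mono-< (hx m n (ℕ.m⊔n≤o⇒m≤o N M p) (ℕ.m⊔n≤o⇒m≤o N M q))
                      (hy m n (ℕ.m⊔n≤o⇒n≤o N M p) (ℕ.m⊔n≤o⇒n≤o N M q)) ⟩
      ½ ℚ.* ε ℚ.+ ½ ℚ.* ε
        ≡⟨ ½ε+½ε≡ε ε ⟩
      ε ∎

-_ : ℝ → ℝ
- x = mkℝ (λ n → ℚ.- seq x n) cauchy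
  where
  cauchy : IsCauchy (λ n → ℚ.- seq x n)
  cauchy ε 0<ε with isCauchy x ε 0<ε
  ... | N , h = N , λ m n p q → subst (ℚ._< ε) (eq (seq x m) (seq x n)) (h m n p q)
    where
    eq : ∀ a b → ℚ.∣ a ℚ.- b ∣ ≡ ℚ.∣ ℚ.- a ℚ.- ℚ.- b ∣
    eq a b = trans (sym (ℚ.∣-p∣≡∣p∣ (a ℚ.- b)))
      (cong ℚ.∣_∣ (ℚ.neg-distrib-+ a (ℚ.- b)))

_-_ : ℝ → ℝ → ℝ
x - y = x + - y

bounded : ∀ x → ∃[ B ] 0ℚ ℚ.< B × ∃[ N ] ∀ n → N ℕ.≤ n → ℚ.∣ seq x n ∣ ℚ.≤ B
bounded x with isCauchy x 1ℚ (ℚ.positive⁻¹ 1ℚ)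
... | N , h = 1ℚ ℚ.+ ℚ.∣ seq x N ∣
            , ℚ.<-≤-trans (ℚ.positive⁻¹ 1ℚ)
                (ℚ.≤-trans (ℚ.≤-reflexive (sym (ℚ.+-identityʳ 1ℚ)))
                  (ℚ.+-monoʳ-≤ 1ℚ (ℚ.0≤∣p∣ (seq x N))))
            , N
            , λ n p → ℚ.≤-trans (∣p∣≤∣p-q∣+∣q∣ (seq x n) (seq x N))
                (ℚ.+-monoˡ-≤ ℚ.∣ seq x N ∣ (ℚ.<⇒≤ (h n N p ℕ.≤-refl)))

_*_ : ℝ → ℝ → ℝ
x * y = mkℝ (λ n → seq x n ℚ.* seq y n) λ ε 0<ε →
  let B , 0<B , N₁ , hB = bounded x
      C , 0<C , N₂ , hC = bounded y
      e = ½ ℚ.* ε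
      N₃ , hx = isCauchy x (e ℚ.* recip C) (0<* {e} {recip C} (0<½* 0<ε) (recip-pos 0<C))
      N₄ , hy = isCauchy y (e ℚ.* recip B) (0<* {e} {recip B} (0<½* 0<ε) (recip-pos 0<B))
  in (N₁ ⊔ N₂) ⊔ (N₃ ⊔ N₄) , λ m n p q →
    let a = seq x m ; b = seq y m ; c = seq x n ; d = seq y n
        p₁₂ = ℕ.m⊔n≤o⇒m≤o (N₁ ⊔ N₂) (N₃ ⊔ N₄) p
        p₃₄ = ℕ.m⊔n≤o⇒n≤o (N₁ ⊔ N₂) (N₃ ⊔ N₄) p
        q₁₂ = ℕ.m⊔n≤o⇒m≤o (N₁ ⊔ N₂) (N₃ ⊔ N₄) q
        q₃₄ = ℕ.m⊔n≤o⇒n≤o (N₁ ⊔ N₂) (N₃ ⊔ N₄) q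
    in subst (ℚ.∣ a ℚ.* b ℚ.- c ℚ.* d ∣ ℚ.<_) (½ε+½ε≡ε ε)
         (products-close a b c d B C e 0<B 0<C
           (hB m (ℕ.m⊔n≤o⇒m≤o N₁ N₂ p₁₂)) (hC n (ℕ.m⊔n≤o⇒n≤o N₁ N₂ q₁₂))
           (hx m n (ℕ.m⊔n≤o⇒m≤o N₃ N₄ p₃₄) (ℕ.m⊔n≤o⇒m≤o N₃ N₄ q₃₄))
           (hy m n (ℕ.m⊔n≤o⇒n≤o N₃ N₄ p₃₄) (ℕ.m⊔n≤o⇒n≤o N₃ N₄ q₃₄)))

_^_ : ℝ → ℕ → ℝ
x ^ zero  = 1ℝ
x ^ suc n = x * x ^ n

∣_∣ : ℝ → ℝ
∣ x ∣ = mkℝ (λ n → ℚ.∣ seq x n ∣) cauchy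
  where
  cauchy : IsCauchy (λ n → ℚ.∣ seq x n ∣)
  cauchy ε 0<ε with isCauchy x ε 0<ε
  ... | N , h = N , λ m n p q →
    let a = seq x m ; b = seq x n in
    ∣∣-bound (ℚ.∣ a ∣ ℚ.- ℚ.∣ b ∣)
      (ℚ.≤-<-trans (≤+⇒-≤ (∣p∣≤∣p-q∣+∣q∣ a b)) (h m n p q))
      (subst (ℚ._< ε) (neg-diff ℚ.∣ a ∣ ℚ.∣ b ∣)
        (ℚ.≤-<-trans (≤+⇒-≤ (∣p∣≤∣p-q∣+∣q∣ b a)) (h n m q p)))

infix 8 _⁻¹[_]

_⁻¹[_] : (x : ℝ) → 0ℝ < x → ℝ
x ⁻¹[ δ , 0<δ , N , δ≤x ] = mkℝ (λ n → recip (seq x n)) cauchy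
  where
  lower : ∀ n → N ℕ.≤ n → δ ℚ.≤ seq x n
  lower n p = subst (ℚ._≤ seq x n) (ℚ.+-identityˡ δ) (δ≤x n p)

  cauchy : IsCauchy (λ n → recip (seq x n))
  cauchy ε 0<ε with isCauchy x (ε ℚ.* (δ ℚ.* δ)) (0<* 0<ε (0<* 0<δ 0<δ))
  ... | M , h = N ⊔ M , λ m n p q →
    let open ℚ.≤-Reasoning
        a = seq x m ; b = seq x n ; r = recip a ; s = recip b
        δ≤a = lower m (ℕ.m⊔n≤o⇒m≤o N M p)
        δ≤b = lower n (ℕ.m⊔n≤o⇒m≤o N M q)
        0<a = ℚ.<-≤-trans 0<δ δ≤a
        0<b = ℚ.<-≤-trans 0<δ δ≤b
        0≤ab = ℚ.<⇒≤ (0<* 0<a 0<b)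
    in ℚ.*-cancelʳ-<-nonNeg (a ℚ.* b) {{ℚ.nonNegative 0≤ab}} (begin-strict
      ℚ.∣ r ℚ.- s ∣ ℚ.* (a ℚ.* b)
        ≡⟨ cong (ℚ.∣ r ℚ.- s ∣ ℚ.*_) (sym (ℚ.0≤p⇒∣p∣≡p 0≤ab)) ⟩
      ℚ.∣ r ℚ.- s ∣ ℚ.* ℚ.∣ a ℚ.* b ∣
        ≡⟨ sym (ℚ.∣p*q∣≡∣p∣*∣q∣ (r ℚ.- s) (a ℚ.* b)) ⟩
      ℚ.∣ (r ℚ.- s) ℚ.* (a ℚ.* b) ∣
        ≡⟨ cong ℚ.∣_∣ (diff-product r s a b) ⟩
      ℚ.∣ (r ℚ.* a) ℚ.* b ℚ.- (s ℚ.* b) ℚ.* a ∣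
        ≡⟨ cong₂ (λ u v → ℚ.∣ u ℚ.* b ℚ.- v ℚ.* a ∣) (recip-inverse 0<a) (recip-inverse 0<b) ⟩
      ℚ.∣ 1ℚ ℚ.* b ℚ.- 1ℚ ℚ.* a ∣
        ≡⟨ cong₂ (λ u v → ℚ.∣ u ℚ.- v ∣) (ℚ.*-identityˡ b) (ℚ.*-identityˡ a) ⟩
      ℚ.∣ b ℚ.- a ∣
        <⟨ h n m (ℕ.m⊔n≤o⇒n≤o N M q) (ℕ.m⊔n≤o⇒n≤o N M p) ⟩
      ε ℚ.* (δ ℚ.* δ)
        ≤⟨ ℚ.*-monoˡ-≤-nonNeg ε {{ℚ.nonNegative (ℚ.<⇒≤ 0<ε)}} (begin
             δ ℚ.* δ ≤⟨ ℚ.*-monoˡ-≤-nonNeg δ {{ℚ.nonNegative (ℚ.<⇒≤ 0<δ)}} δ≤b ⟩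
             δ ℚ.* b ≤⟨ ℚ.*-monoʳ-≤-nonNeg b {{ℚ.nonNegative (ℚ.<⇒≤ 0<b)}} δ≤a ⟩
             a ℚ.* b ∎) ⟩
      ε ℚ.* (a ℚ.* b) ∎)

⌊log₂⌋-lower : ∀ n .{{_ : NonZero n}} → 2 ℕ.^ ⌊log₂ n ⌋ ℕ.≤ n
⌊log₂⌋-lower n {{n≢0}} = <-rec P step n (ℕ.>-nonZero⁻¹ n)
  where
  P : ℕ → Set
  P n = 0 ℕ.< n → 2 ℕ.^ ⌊log₂ n ⌋ ℕ.≤ n

  step : ∀ n → (∀ {m} → m ℕ.< n → P m) → P n
  step 1 _ _ = ℕ.≤-refl
  step n@(suc (suc k)) rec _ = begin
    2 ℕ.^ ⌊log₂ n ⌋                 ≤⟨ ℕ.^-monoʳ-≤ 2 (ℕ.m≤n+m∸n ⌊log₂ n ⌋ 1) ⟩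
    2 ℕ.* 2 ℕ.^ (⌊log₂ n ⌋ ∸ 1)     ≡⟨ cong (λ e → 2 ℕ.* 2 ℕ.^ e) (sym (⌊log₂⌊n/2⌋⌋≡⌊log₂n⌋∸1 n)) ⟩
    2 ℕ.* 2 ℕ.^ ⌊log₂ ℕ.⌊ n /2⌋ ⌋   ≤⟨ ℕ.*-monoʳ-≤ 2 (rec (ℕ.⌊n/2⌋<n (suc k)) (ℕ.s≤s ℕ.z≤n)) ⟩
    2 ℕ.* ℕ.⌊ n /2⌋                 ≡⟨ cong (ℕ.⌊ n /2⌋ ℕ.+_) (ℕ.+-identityʳ ℕ.⌊ n /2⌋) ⟩
    ℕ.⌊ n /2⌋ ℕ.+ ℕ.⌊ n /2⌋         ≤⟨ ℕ.+-monoʳ-≤ ℕ.⌊ n /2⌋ (ℕ.⌊n/2⌋≤⌈n/2⌉ n) ⟩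
    ℕ.⌊ n /2⌋ ℕ.+ ℕ.⌈ n /2⌉         ≡⟨ ℕ.⌊n/2⌋+⌈n/2⌉≡n n ⟩
    n ∎
    where open ℕ.≤-Reasoning

⌊log₂⌋-upper : ∀ n → n ℕ.≤ 2 ℕ.^ suc ⌊log₂ n ⌋
⌊log₂⌋-upper n with n ℕ.≤? 2 ℕ.^ suc ⌊log₂ n ⌋
... | yes h = h
... | no ¬h = ⊥-elim (ℕ.<-irrefl refl (begin-strict
  ⌊log₂ n ⌋                       <⟨ ℕ.n<1+n ⌊log₂ n ⌋ ⟩
  suc ⌊log₂ n ⌋                   ≡⟨ sym (⌊log₂[2^n]⌋≡n (suc ⌊log₂ n ⌋)) ⟩
  ⌊log₂ 2 ℕ.^ suc ⌊log₂ n ⌋ ⌋     ≤⟨ ⌊log₂⌋-mono-≤ (ℕ.<⇒≤ (ℕ.≰⇒> ¬h)) ⟩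
  ⌊log₂ n ⌋                       ∎))
  where open ℕ.≤-Reasoning

2^-cancel-≤ : ∀ a b → 2 ℕ.^ a ℕ.≤ 2 ℕ.^ b → a ℕ.≤ b
2^-cancel-≤ a b h with a ℕ.≤? b
... | yes a≤b = a≤b
... | no  a≰b = ⊥-elim (ℕ.<⇒≱ (ℕ.^-monoʳ-< 2 (ℕ.n<1+n 1) (ℕ.≰⇒> a≰b)) h)

exponents-≤ : ∀ ℓ a b c d → 2 ℕ.^ a ℕ.≤ ℓ ℕ.^ suc b → ℓ ℕ.^ suc d ℕ.≤ 2 ℕ.^ c →
  + a ℚ./ suc b ℚ.≤ + c ℚ./ suc d
exponents-≤ ℓ a b c d h k = fraction-≤ {a} {b} {c} {d} (2^-cancel-≤ (a ℕ.* suc d) (c ℕ.* suc b) (begin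
  2 ℕ.^ (a ℕ.* suc d)          ≡⟨ sym (ℕ.^-*-assoc 2 a (suc d)) ⟩
  (2 ℕ.^ a) ℕ.^ suc d          ≤⟨ ℕ.^-monoˡ-≤ (suc d) h ⟩
  (ℓ ℕ.^ suc b) ℕ.^ suc d      ≡⟨ ℕ.^-*-assoc ℓ (suc b) (suc d) ⟩
  ℓ ℕ.^ (suc b ℕ.* suc d)      ≡⟨ cong (ℓ ℕ.^_) (ℕ.*-comm (suc b) (suc d)) ⟩
  ℓ ℕ.^ (suc d ℕ.* suc b)      ≡⟨ sym (ℕ.^-*-assoc ℓ (suc d) (suc b)) ⟩
  (ℓ ℕ.^ suc d) ℕ.^ suc b      ≤⟨ ℕ.^-monoˡ-≤ (suc b) k ⟩
  (2 ℕ.^ c) ℕ.^ suc b          ≡⟨ ℕ.^-*-assoc 2 c (suc b) ⟩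
  2 ℕ.^ (c ℕ.* suc b)          ∎))
  where open ℕ.≤-Reasoning

log₂-approx : ℕ → ℕ → ℚ
log₂-approx ℓ n = + ⌊log₂ ℓ ℕ.^ suc n ⌋ ℚ./ suc n

log₂-approx-lower : ∀ ℓ a b n → 2 ℕ.^ a ℕ.≤ ℓ ℕ.^ suc b →
  + a ℚ./ suc b ℚ.≤ log₂-approx ℓ n ℚ.+ + 1 ℚ./ suc n
log₂-approx-lower ℓ a b n h = ℚ.≤-trans
  (exponents-≤ ℓ a b (suc ⌊log₂ ℓ ℕ.^ suc n ⌋) n h (⌊log₂⌋-upper (ℓ ℕ.^ suc n)))
  (fraction-suc ⌊log₂ ℓ ℕ.^ suc n ⌋ n)

-- log₂ ℓ = lim ⌊log₂ (ℓ ^ n)⌋ / n; log₂-≥ and log₂-≤ below locate it among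
-- the rationals a / b by comparing 2 ^ a with ℓ ^ b.
log₂ : (ℓ : ℕ) .{{_ : NonZero ℓ}} → ℝ
log₂ ℓ = mkℝ (log₂-approx ℓ) cauchy
  where
  close : ∀ m n {ε} → + 1 ℚ./ suc n ℚ.< ε → log₂-approx ℓ m ℚ.- log₂-approx ℓ n ℚ.< ε
  close m n h = ℚ.≤-<-trans
    (≤+⇒-≤ {log₂-approx ℓ m} {log₂-approx ℓ n} (ℚ.≤-trans
      (log₂-approx-lower ℓ ⌊log₂ ℓ ℕ.^ suc m ⌋ m n
        (⌊log₂⌋-lower (ℓ ℕ.^ suc m) {{ℕ.m^n≢0 ℓ (suc m)}}))
      (ℚ.≤-reflexive (ℚ.+-comm (log₂-approx ℓ n) (+ 1 ℚ./ suc n)))))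
    h

  cauchy : IsCauchy (log₂-approx ℓ)
  cauchy ε 0<ε with 1/n-small 0<ε
  ... | N , h = N , λ m n p q →
    let a = log₂-approx ℓ m ; b = log₂-approx ℓ n in
    ∣∣-bound (a ℚ.- b) (close m n (h n q))
      (subst (ℚ._< ε) (neg-diff a b) (close n m (h m p)))

log₂-≥ : ∀ ℓ .{{_ : NonZero ℓ}} a b → 2 ℕ.^ a ℕ.≤ ℓ ℕ.^ suc b → fromℚ (+ a ℚ./ suc b) ≤ log₂ ℓ
log₂-≥ ℓ a b h ε 0<ε with 1/n-small 0<ε
... | N , small = N , λ n p → ℚ.≤-trans (log₂-approx-lower ℓ a b n h)
  (ℚ.+-monoʳ-≤ (log₂-approx ℓ n) (ℚ.<⇒≤ (small n p)))

log₂-≤ : ∀ ℓ .{{_ : NonZero ℓ}} a b → ℓ ℕ.^ suc b ℕ.≤ 2 ℕ.^ a → log₂ ℓ ≤ fromℚ (+ a ℚ./ suc b)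
log₂-≤ ℓ a b h ε 0<ε = 0 , λ n _ → ℚ.≤-trans
  (exponents-≤ ℓ ⌊log₂ ℓ ℕ.^ suc n ⌋ n a b (⌊log₂⌋-lower (ℓ ℕ.^ suc n) {{ℕ.m^n≢0 ℓ (suc n)}}) h)
  (≤+pos (+ a ℚ./ suc b) ε 0<ε)

instance
  n⊔2≢0 : ∀ {n} → NonZero (n ⊔ 2)
  n⊔2≢0 {n} = ℕ.>-nonZero (ℕ.≤-trans (ℕ.s≤s ℕ.z≤n) (ℕ.m≤n⊔m n 2))

Eventually : (ℕ → Set) → Set
Eventually P = ∃[ N ] ∀ n → N ℕ.≤ n → P n

_⟶_ : (ℕ → ℝ) → ℝ → Set
a ⟶ L = ∀ ε → 0ℝ < ε → Eventually λ n → ∣ a n - L ∣ < ε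

infix 4 _≪_[_]

-- a n / b n → 0; the positivity proof is what makes the quotient available.
_≪_[_] : (a b : ℕ → ℝ) → (∀ n → 0ℝ < b n) → Set
a ≪ b [ b>0 ] = (λ n → a n * b n ⁻¹[ b>0 n ]) ⟶ 0ℝ

IsPositiveRoot : ℕ → ℝ → ℝ → Set
IsPositiveRoot k x r = 0ℝ < r × r ^ k ≃ x

-- The extremal quantities (dim, ℓ₀, q) and p_c are specified by predicates
-- characterising their value, which is unique (up to _≃_ for reals).
IsMinimum : (ℕ → Set) → ℕ → Set
IsMinimum P k = P k × (∀ j → P j → k ℕ.≤ j)

IsMaximum : (ℕ → Set) → ℕ → Set
IsMaximum P k = P k × (∀ j → P j → j ℕ.≤ k)

IsMaximumℝ : (ℝ → Set) → ℝ → Set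
IsMaximumℝ P x = P x × (∀ y → P y → y ≤ x)

-- X is taken to be Fin m.  A set of subsets of X is given by its
-- characteristic function on 2^X, so that it can be counted and summed over.
Family : ℕ → Set
Family m = Subset m → Bool

private variable
  m : ℕ

infix 4 _∈_ _∉_

_∈_ _∉_ : Subset m → Family m → Set
S ∈ 𝓖 = T (𝓖 S)
S ∉ 𝓖 = ¬ S ∈ 𝓖

subsets : ∀ m → List (Subset m)
subsets zero    = List.[ [] ]
subsets (suc m) = List.map (outside ∷_) (subsets m) ++ List.map (inside ∷_) (subsets m)

members : Family m → List (Subset m)
members 𝓖 = filterᵇ 𝓖 (subsets _)

card : Family m → ℕ
card 𝓖 = length (members 𝓖)

∑ : Family m → (Subset m → ℝ) → ℝ
∑ 𝓖 f = foldr (λ S acc → f S + acc) 0ℝ (members 𝓖)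

IsUpperSet : Family m → Set
IsUpperSet 𝓕 = ∀ A B → A ∈ 𝓕 → A ⊆ B → B ∈ 𝓕

Nontrivial : Family m → Set
Nontrivial 𝓕 = (∃[ A ] A ∈ 𝓕) × (∃[ A ] A ∉ 𝓕)

infix 4 _∈⟨_⟩

_∈⟨_⟩ : Subset m → Family m → Set
A ∈⟨ 𝓖 ⟩ = ∃[ S ] S ∈ 𝓖 × S ⊆ A

_Covers_ : Family m → Family m → Set
𝓖 Covers 𝓕 = ∀ A → A ∈ 𝓕 → A ∈⟨ 𝓖 ⟩

μ : ℝ → Family m → ℝ
μ {m} p 𝓕 = ∑ 𝓕 λ S → p ^ ∥ S ∥ * (1ℝ - p) ^ (m ∸ ∥ S ∥)

InUnitInterval : ℝ → Set
InUnitInterval p = 0ℝ ≤ p × p ≤ 1ℝ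

IsCriticalProbability : Family m → ℝ → Set
IsCriticalProbability 𝓕 p = InUnitInterval p × μ p 𝓕 ≃ ½ℝ

_IsSmall_ : Family m → ℝ → Set
𝓕 IsSmall p = ∃[ 𝓖 ] 𝓖 Covers 𝓕 × ∑ 𝓖 (λ S → p ^ ∥ S ∥) ≤ ½ℝ

IsExpectationThreshold : Family m → ℝ → Set
IsExpectationThreshold 𝓕 = IsMaximumℝ λ p → InUnitInterval p × 𝓕 IsSmall p

IsCoveringDimension : Family m → ℕ → Set
IsCoveringDimension 𝓕 = IsMinimum λ k →
  ∃[ 𝓖 ] 𝓖 Covers 𝓕 × ¬ (∀ A → A ∈⟨ 𝓖 ⟩) × card 𝓖 ≡ k

IsMinimalIn : Family m → Subset m → Set
IsMinimalIn 𝓕 S = S ∈ 𝓕 × (∀ A → A ∈ 𝓕 → A ⊆ S → A ≡ S)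

Isℓ₀ : Family m → ℕ → Set
Isℓ₀ 𝓕 = IsMaximum λ k → ∃[ S ] IsMinimalIn 𝓕 S × ∥ S ∥ ≡ k

module _ (K : ℝ) (q logℓ : ℕ → ℝ) where

  NontrivialInformation : Set
  NontrivialInformation = Eventually λ n → K * q n * logℓ n < 1ℝ

  AsymptoticallyPerfectInformation : Set
  AsymptoticallyPerfectInformation = (λ n → (K * logℓ n - 1ℝ) * q n) ⟶ 0ℝ

{-# OPTIONS --safe #-}

-- If 𝓖 is a cover witnessing that 𝓕 is q-small, then 𝓖 does not contain ∅
-- (which alone contributes q⁰ = 1 > ½), and those of its members of size at
-- most ℓ still cover 𝓕: below each A ∈ 𝓕 lies a minimal M ∈ 𝓕, and the member
-- of 𝓖 contained in M has size at most |M| ≤ ℓ.  So at least dim 𝓕 members of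
-- 𝓖 have weight at least q^ℓ, which gives dim 𝓕 · q^ℓ ≤ ½.  Hence
-- (K q log ℓ)^ℓ < 1 under (i), while under (ii) q (2 dim 𝓕)^(1/ℓ) ≤ 1 and
-- q ≤ q log ℓ ≤ log ℓ / (2 dim 𝓕)^(1/ℓ) → 0.
module Submission where

open import Defs
open import Data.Bool.Base using (_∧_)
open import Data.Bool.Properties using (T?; T-∧)
open import Data.Empty using (⊥-elim)
open import Data.Fin.Subset using (Subset; outside; _⊆_) renaming (∣_∣ to ∥_∥; ⊥ to ∅)
open import Data.Fin.Subset.Properties
  using (⊆-antisym; ⊥⊆; ∣⊥∣≡0; _∈?_; _⊂?_; anySubset?; p⊂q⇒∣p∣<∣q∣; p⊆q⇒∣p∣≤∣q∣)
open import Data.Fin.Properties using (any?)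
open import Data.Integer.Base as ℤ using (+_)
import Data.Integer.Properties as ℤ
open import Data.List.Base using (List; []; _∷_; foldr; length)
open import Data.List.Membership.Propositional using () renaming (_∈_ to _∈ₗ_)
open import Data.List.Membership.Propositional.Properties using (∈-++⁺ˡ; ∈-map⁺; ∈-filter⁺)
open import Data.List.Relation.Binary.Sublist.Propositional
  using ([]; _∷_; _∷ʳ_; from∈) renaming (_⊆_ to _⊑_; ⊆-refl to ⊑-refl)
open import Data.List.Relation.Binary.Sublist.Propositional.Properties using (filter⁺)
open import Data.List.Relation.Unary.All as All using (All; []; _∷_)
open import Data.List.Relation.Unary.All.Properties using (all-filter)
open import Data.List.Relation.Unary.Any using (here)
open import Data.Nat.Base as ℕ using (ℕ; zero; suc; NonZero; _⊔_)
import Data.Nat.Properties as ℕ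
open import Data.Nat.Induction using (<-rec)
open import Data.Product.Base using (∃-syntax; _×_; _,_; proj₁; proj₂)
open import Data.Rational.Base as ℚ using (ℚ; 0ℚ; 1ℚ; ½)
import Data.Rational.Properties as ℚ
import Data.Rational.Unnormalised.Base as ℚᵘ
import Data.Rational.Unnormalised.Properties as ℚᵘ
open import Data.Rational.Solver using (module +-*-Solver)
open import Data.Sum.Base using (inj₁; inj₂)
open import Data.Vec.Base using (_∷_)
open import Function.Bundles using (Equivalence)
open import Relation.Binary.Bundles using (Preorder)
open import Relation.Binary.PropositionalEquality
  using (_≡_; refl; sym; trans; cong; cong₂; subst; subst₂; isEquivalence;
    module ≡-Reasoning)
import Relation.Binary.Reasoning.Preorder
open import Relation.Nullary using (¬_; ¬?; yes; no; _×-dec_)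
open import Relation.Nullary.Decidable using (decidable-stable; toWitnessFalse)

open +-*-Solver using (solve; _:=_; _:+_; _:*_; _:-_; :-_; con)

-- Rational inequalities and the embedding of the naturals.

0≤p*q : ∀ {p q} → 0ℚ ℚ.≤ p → 0ℚ ℚ.≤ q → 0ℚ ℚ.≤ p ℚ.* q
0≤p*q {p} {q} 0≤p 0≤q = ℚ.nonNegative⁻¹ (p ℚ.* q)
  {{ℚ.nonNeg*nonNeg⇒nonNeg p {{ℚ.nonNegative 0≤p}} q {{ℚ.nonNegative 0≤q}}}}

0≤p+q : ∀ {p q} → 0ℚ ℚ.≤ p → 0ℚ ℚ.≤ q → 0ℚ ℚ.≤ p ℚ.+ q
0≤p+q = ℚ.+-mono-≤

p≤q⇒0≤q-p : ∀ {p q} → p ℚ.≤ q → 0ℚ ℚ.≤ q ℚ.- p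
p≤q⇒0≤q-p {p} {q} p≤q =
  subst (ℚ._≤ q ℚ.- p) (ℚ.+-inverseʳ p) (ℚ.+-monoˡ-≤ (ℚ.- p) p≤q)

-- The difference `d` is a free argument: its sign is proved on an expression built from nonnegative
-- pieces, and the ring solver then identifies it with `q - p`.
≤-fromDiff : ∀ {p q d} → 0ℚ ℚ.≤ d → d ≡ q ℚ.- p → p ℚ.≤ q
≤-fromDiff {p} {q} 0≤d refl =
  subst₂ ℚ._≤_ (ℚ.+-identityˡ p) (solve 2 (λ q p → q :- p :+ p := q) refl q p) (ℚ.+-monoˡ-≤ p 0≤d)

∣p∣≤ : ∀ {p r} → p ℚ.≤ r → 0ℚ ℚ.≤ p ℚ.+ r → ℚ.∣ p ∣ ℚ.≤ r
∣p∣≤ {p} {r} p≤r 0≤p+r with ℚ.∣p∣≡p∨∣p∣≡-p p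
... | inj₁ eq = subst (ℚ._≤ r) (sym eq) p≤r
... | inj₂ eq = subst (ℚ._≤ r) (sym eq)
  (≤-fromDiff 0≤p+r (solve 2 (λ p r → p :+ r := r :- (:- p)) refl p r))

p≤∣p∣ : ∀ p → p ℚ.≤ ℚ.∣ p ∣
p≤∣p∣ p with ℚ.≤-total 0ℚ p
... | inj₁ 0≤p = ℚ.≤-reflexive (sym (ℚ.0≤p⇒∣p∣≡p 0≤p))
... | inj₂ p≤0 = ℚ.≤-trans p≤0 (ℚ.0≤∣p∣ p)

-- The fraction `+ n / 1` is normalised by a gcd that does not compute for a variable `n`; among
-- unnormalised rationals the claim is an integer identity.
fromℕ-+ : ∀ m n → + (m ℕ.+ n) ℚ./ 1 ≡ + m ℚ./ 1 ℚ.+ + n ℚ./ 1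
fromℕ-+ m n = ℚ.toℚᵘ-injective (begin-equality
  ℚ.toℚᵘ (+ (m ℕ.+ n) ℚ./ 1)                        ≃⟨ ℚ.toℚᵘ-fromℚᵘ (ℚᵘ.mkℚᵘ (+ (m ℕ.+ n)) 0) ⟩
  ℚᵘ.mkℚᵘ (+ (m ℕ.+ n)) 0                           ≃⟨ ℚᵘ.*≡* (eq (+ m) (+ n)) ⟩
  ℚᵘ.mkℚᵘ (+ m) 0 ℚᵘ.+ ℚᵘ.mkℚᵘ (+ n) 0              ≃⟨ ℚᵘ.+-cong (ℚ.toℚᵘ-fromℚᵘ (ℚᵘ.mkℚᵘ (+ m) 0)) (ℚ.toℚᵘ-fromℚᵘ (ℚᵘ.mkℚᵘ (+ n) 0)) ⟨
  ℚ.toℚᵘ (+ m ℚ./ 1) ℚᵘ.+ ℚ.toℚᵘ (+ n ℚ./ 1)        ≃⟨ ℚ.toℚᵘ-homo-+ (+ m ℚ./ 1) (+ n ℚ./ 1) ⟨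
  ℚ.toℚᵘ (+ m ℚ./ 1 ℚ.+ + n ℚ./ 1)                  ∎)
  where
  open ℚᵘ.≤-Reasoning
  eq : ∀ i j → (i ℤ.+ j) ℤ.* (+ 1 ℤ.* + 1) ≡ (i ℤ.* + 1 ℤ.+ j ℤ.* + 1) ℤ.* + 1
  eq i j = cong (ℤ._* + 1) (sym (cong₂ ℤ._+_ (ℤ.*-identityʳ i) (ℤ.*-identityʳ j)))

fromℕ-suc : ∀ n → + suc n ℚ./ 1 ≡ 1ℚ ℚ.+ + n ℚ./ 1
fromℕ-suc = fromℕ-+ 1

0≤fromℕ : ∀ n → 0ℚ ℚ.≤ + n ℚ./ 1
0≤fromℕ n = ℚ.nonNegative⁻¹ (+ n ℚ./ 1) {{ℚ.normalize-nonNeg n 1}}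

fromℕ-mono-≤ : ∀ {m n} → m ℕ.≤ n → + m ℚ./ 1 ℚ.≤ + n ℚ./ 1
fromℕ-mono-≤ {m} {n} m≤n = fraction-≤ {m} {0} {n} {0} (ℕ.*-monoˡ-≤ 1 m≤n)

-- Order and addition of reals.

≤⇒diff : ∀ x y → x ≤ y → 0ℝ ≤ y - x
≤⇒diff x y x≤y ε 0<ε with x≤y ε 0<ε
... | N , h = N , λ k p → ≤-fromDiff (p≤q⇒0≤q-p (h k p))
  (solve 3 (λ x y e → y :+ e :- x := y :- x :+ e :- con 0ℚ) refl (seq x k) (seq y k) ε)

diff⇒≤ : ∀ x y → 0ℝ ≤ y - x → x ≤ y
diff⇒≤ x y 0≤y-x ε 0<ε with 0≤y-x ε 0<ε
... | N , h = N , λ k p → ≤-fromDiff (h k p)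
  (solve 3 (λ x y e → y :- x :+ e := y :+ e :- x) refl (seq x k) (seq y k) ε)

eventually-≤ : ∀ x y N → (∀ k → N ℕ.≤ k → seq x k ℚ.≤ seq y k) → x ≤ y
eventually-≤ x y N x≤y ε 0<ε = N , λ k p → ℚ.≤-trans (x≤y k p) (≤+pos (seq y k) ε 0<ε)

pointwise-≤ : ∀ x y → (∀ k → seq x k ℚ.≤ seq y k) → x ≤ y
pointwise-≤ x y x≤y = eventually-≤ x y 0 λ k _ → x≤y k

-- Reals that agree at every index may still differ in their Cauchy moduli, so ring identities enter
-- the chains of inequalities as `_≤_` instead of `_≡_`.
pointwise-≡ : ∀ x y → (∀ k → seq x k ≡ seq y k) → x ≤ y
pointwise-≡ x y x≡y = pointwise-≤ x y λ k → ℚ.≤-reflexive (x≡y k)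

≤-refl : ∀ x → x ≤ x
≤-refl x = pointwise-≤ x x λ _ → ℚ.≤-refl

≤-trans : ∀ x y z → x ≤ y → y ≤ z → x ≤ z
≤-trans x y z x≤y y≤z ε 0<ε with x≤y (½ ℚ.* ε) (0<½* 0<ε) | y≤z (½ ℚ.* ε) (0<½* 0<ε)
... | N , h | M , h′ = N ⊔ M , λ k p → begin
  seq x k                                ≤⟨ h k (ℕ.m⊔n≤o⇒m≤o N M p) ⟩
  seq y k ℚ.+ ½ ℚ.* ε                    ≤⟨ ℚ.+-monoˡ-≤ (½ ℚ.* ε) (h′ k (ℕ.m⊔n≤o⇒n≤o N M p)) ⟩
  seq z k ℚ.+ ½ ℚ.* ε ℚ.+ ½ ℚ.* ε        ≡⟨ ℚ.+-assoc (seq z k) (½ ℚ.* ε) (½ ℚ.* ε) ⟩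
  seq z k ℚ.+ (½ ℚ.* ε ℚ.+ ½ ℚ.* ε)      ≡⟨ cong (seq z k ℚ.+_) (½ε+½ε≡ε ε) ⟩
  seq z k ℚ.+ ε                          ∎
  where open ℚ.≤-Reasoning

≤-preorder : Preorder _ _ _
≤-preorder = record
  { Carrier    = ℝ
  ; _≈_        = _≡_
  ; _≲_        = _≤_
  ; isPreorder = record
    { isEquivalence = isEquivalence
    ; reflexive     = λ { {x} refl → ≤-refl x }
    ; trans         = λ {x} {y} {z} → ≤-trans x y z
    }
  }

module ≤-Reasoning = Relation.Binary.Reasoning.Preorder ≤-preorder

≤-<-trans : ∀ x y z → x ≤ y → y < z → x < z
≤-<-trans x y z x≤y (δ , 0<δ , N , h) with x≤y (½ ℚ.* δ) (0<½* 0<δ)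
-- Half of the gap `δ` absorbs the slack in `x ≤ y`; the other half remains as the new gap.
... | M , h′ = ½ ℚ.* δ , 0<½* 0<δ , N ⊔ M , λ k p →
  ≤-fromDiff (0≤p+q (p≤q⇒0≤q-p (h k (ℕ.m⊔n≤o⇒m≤o N M p))) (p≤q⇒0≤q-p (h′ k (ℕ.m⊔n≤o⇒n≤o N M p))))
    (solve 4 (λ x y z δ → (z :- (y :+ δ)) :+ (y :+ con ½ :* δ :- x) := z :- (x :+ con ½ :* δ))
      refl (seq x k) (seq y k) (seq z k) δ)

<⇒≤ : ∀ x y → x < y → x ≤ y
<⇒≤ x y (δ , 0<δ , N , h) = eventually-≤ x y N λ k p → ℚ.≤-trans (≤+pos (seq x k) δ 0<δ) (h k p)

+-mono-≤ : ∀ x y u v → x ≤ y → u ≤ v → x + u ≤ y + v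
+-mono-≤ x y u v x≤y u≤v ε 0<ε with x≤y (½ ℚ.* ε) (0<½* 0<ε) | u≤v (½ ℚ.* ε) (0<½* 0<ε)
... | N , h | M , h′ = N ⊔ M , λ k p →
  ≤-fromDiff (0≤p+q (p≤q⇒0≤q-p (h k (ℕ.m⊔n≤o⇒m≤o N M p))) (p≤q⇒0≤q-p (h′ k (ℕ.m⊔n≤o⇒n≤o N M p))))
    (solve 5 (λ x y u v ε → (y :+ con ½ :* ε :- x) :+ (v :+ con ½ :* ε :- u) := y :+ v :+ ε :- (x :+ u))
      refl (seq x k) (seq y k) (seq u k) (seq v k) ε)

-- Multiplication and nonnegative reals.

-- A nonnegative real may have approximations as low as `-η`. If `a` is nonnegative, the claim is
-- the sum of `a * (b + η)` and `η * (C - a)`, and symmetrically for `b`; if both are nonpositive,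
-- `a * b` is already nonnegative.
approx-*-nonNeg : ∀ {a b C η} → 0ℚ ℚ.≤ η → 0ℚ ℚ.≤ C → a ℚ.≤ C → b ℚ.≤ C →
  0ℚ ℚ.≤ a ℚ.+ η → 0ℚ ℚ.≤ b ℚ.+ η → 0ℚ ℚ.≤ a ℚ.* b ℚ.+ η ℚ.* C
approx-*-nonNeg {a} {b} {C} {η} 0≤η 0≤C a≤C b≤C 0≤a+η 0≤b+η with ℚ.≤-total 0ℚ a | ℚ.≤-total 0ℚ b
... | inj₁ 0≤a | _ = subst (0ℚ ℚ.≤_)
  (solve 4 (λ a b C η → a :* (b :+ η) :+ η :* (C :- a) := a :* b :+ η :* C) refl a b C η)
  (0≤p+q (0≤p*q 0≤a 0≤b+η) (0≤p*q 0≤η (p≤q⇒0≤q-p a≤C)))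
... | inj₂ _ | inj₁ 0≤b = subst (0ℚ ℚ.≤_)
  (solve 4 (λ a b C η → b :* (a :+ η) :+ η :* (C :- b) := a :* b :+ η :* C) refl a b C η)
  (0≤p+q (0≤p*q 0≤b 0≤a+η) (0≤p*q 0≤η (p≤q⇒0≤q-p b≤C)))
... | inj₂ a≤0 | inj₂ b≤0 = subst (0ℚ ℚ.≤_)
  (solve 4 (λ a b C η → (con 0ℚ :- a) :* (con 0ℚ :- b) :+ η :* C := a :* b :+ η :* C) refl a b C η)
  (0≤p+q (0≤p*q (p≤q⇒0≤q-p a≤0) (p≤q⇒0≤q-p b≤0))
    (0≤p*q 0≤η 0≤C))

recip-cancelʳ : ∀ p {q} → 0ℚ ℚ.< q → p ℚ.* recip q ℚ.* q ≡ p
recip-cancelʳ p {q} 0<q = begin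
  p ℚ.* recip q ℚ.* q      ≡⟨ ℚ.*-assoc p (recip q) q ⟩
  p ℚ.* (recip q ℚ.* q)    ≡⟨ cong (p ℚ.*_) (recip-inverse 0<q) ⟩
  p ℚ.* 1ℚ                 ≡⟨ ℚ.*-identityʳ p ⟩
  p                        ∎
  where open ≡-Reasoning

*-nonNeg : ∀ x y → 0ℝ ≤ x → 0ℝ ≤ y → 0ℝ ≤ x * y
*-nonNeg x y 0≤x 0≤y ε 0<ε =
  let A , 0<A , N₁ , hA = bounded x
      B , 0<B , N₂ , hB = bounded y
      0<C : 0ℚ ℚ.< A ℚ.+ B
      0<C = ℚ.+-mono-< 0<A 0<B
      -- `A + B` bounds both factors, and with this `η` the error `η * (A + B)` is exactly `ε`.
      η = ε ℚ.* recip (A ℚ.+ B)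
      0<η : 0ℚ ℚ.< η
      0<η = 0<* {ε} {recip (A ℚ.+ B)} 0<ε (recip-pos 0<C)
      N₃ , hx = 0≤x η 0<η
      N₄ , hy = 0≤y η 0<η
  in (N₁ ⊔ N₂) ⊔ (N₃ ⊔ N₄) , λ k p →
    let p₁₂ = ℕ.m⊔n≤o⇒m≤o (N₁ ⊔ N₂) (N₃ ⊔ N₄) p
        p₃₄ = ℕ.m⊔n≤o⇒n≤o (N₁ ⊔ N₂) (N₃ ⊔ N₄) p
        a = seq x k ; b = seq y k
        a≤A = ℚ.≤-trans (p≤∣p∣ a) (hA k (ℕ.m⊔n≤o⇒m≤o N₁ N₂ p₁₂))
        b≤B = ℚ.≤-trans (p≤∣p∣ b) (hB k (ℕ.m⊔n≤o⇒n≤o N₁ N₂ p₁₂))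
    in subst (λ e → 0ℚ ℚ.≤ a ℚ.* b ℚ.+ e) (recip-cancelʳ ε 0<C)
         (approx-*-nonNeg {a} {b} {A ℚ.+ B} {η} (ℚ.<⇒≤ 0<η) (ℚ.<⇒≤ 0<C)
           (ℚ.≤-trans a≤A (≤+pos A B 0<B))
           (ℚ.≤-trans b≤B (subst (B ℚ.≤_) (ℚ.+-comm B A) (≤+pos B A 0<A)))
           (hx k (ℕ.m⊔n≤o⇒m≤o N₃ N₄ p₃₄)) (hy k (ℕ.m⊔n≤o⇒n≤o N₃ N₄ p₃₄)))

*-monoˡ-≤ : ∀ z x y → 0ℝ ≤ z → x ≤ y → z * x ≤ z * y
*-monoˡ-≤ z x y 0≤z x≤y = diff⇒≤ (z * x) (z * y) (begin
  0ℝ               ≲⟨ *-nonNeg z (y - x) 0≤z (≤⇒diff x y x≤y) ⟩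
  z * (y - x)      ≲⟨ pointwise-≡ (z * (y - x)) (z * y - z * x) (λ k →
                        solve 3 (λ z x y → z :* (y :- x) := z :* y :- z :* x)
                          refl (seq z k) (seq x k) (seq y k)) ⟩
  z * y - z * x    ∎)
  where open ≤-Reasoning

*-comm-≤ : ∀ x y → x * y ≤ y * x
*-comm-≤ x y = pointwise-≡ (x * y) (y * x) λ k → ℚ.*-comm (seq x k) (seq y k)

*-identityʳ-≤ : ∀ x → x * 1ℝ ≤ x
*-identityʳ-≤ x = pointwise-≡ (x * 1ℝ) x λ k → ℚ.*-identityʳ (seq x k)

*-identityʳ-≥ : ∀ x → x ≤ x * 1ℝ
*-identityʳ-≥ x = pointwise-≡ x (x * 1ℝ) λ k → sym (ℚ.*-identityʳ (seq x k))

fromℚ-mono-≤ : ∀ {p q} → p ℚ.≤ q → fromℚ p ≤ fromℚ q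
fromℚ-mono-≤ {p} {q} p≤q = pointwise-≤ (fromℚ p) (fromℚ q) λ _ → p≤q

0≤1 : 0ℝ ≤ 1ℝ
0≤1 = fromℚ-mono-≤ (ℚ.<⇒≤ (ℚ.positive⁻¹ 1ℚ))

fromℚ-cancel-< : ∀ {p q} → fromℚ p < fromℚ q → p ℚ.< q
fromℚ-cancel-< {p} {q} (δ , 0<δ , N , h) = ℚ.<-≤-trans
  (subst (ℚ._< p ℚ.+ δ) (ℚ.+-identityʳ p) (ℚ.+-monoʳ-< p 0<δ)) (h N ℕ.≤-refl)

-- Powers, Bernoulli's inequality and comparison of roots with 1.

^-nonNeg : ∀ x n → 0ℝ ≤ x → 0ℝ ≤ x ^ n
^-nonNeg x zero    0≤x = 0≤1
^-nonNeg x (suc n) 0≤x = *-nonNeg x (x ^ n) 0≤x (^-nonNeg x n 0≤x)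

^-antitone : ∀ x {m n} → 0ℝ ≤ x → x ≤ 1ℝ → m ℕ.≤ n → x ^ n ≤ x ^ m
^-antitone x {n = zero}  0≤x x≤1 ℕ.z≤n = ≤-refl 1ℝ
^-antitone x {n = suc n} 0≤x x≤1 ℕ.z≤n = begin
  x * x ^ n    ≲⟨ *-monoˡ-≤ x (x ^ n) 1ℝ 0≤x (^-antitone x {n = n} 0≤x x≤1 ℕ.z≤n) ⟩
  x * 1ℝ       ≲⟨ *-identityʳ-≤ x ⟩
  x            ≲⟨ x≤1 ⟩
  1ℝ           ∎
  where open ≤-Reasoning
^-antitone x {suc m} {suc n} 0≤x x≤1 (ℕ.s≤s m≤n) =
  *-monoˡ-≤ x (x ^ n) (x ^ m) 0≤x (^-antitone x 0≤x x≤1 m≤n)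

^-distribʳ-* : ∀ x y n k → seq ((x * y) ^ n) k ≡ seq (x ^ n * y ^ n) k
^-distribʳ-* x y zero    k = refl
^-distribʳ-* x y (suc n) k = trans
  (cong (seq x k ℚ.* seq y k ℚ.*_) (^-distribʳ-* x y n k))
  (solve 4 (λ x y u v → x :* y :* (u :* v) := x :* u :* (y :* v))
    refl (seq x k) (seq y k) (seq (x ^ n) k) (seq (y ^ n) k))

1≤^ : ∀ x k n → 1ℚ ℚ.≤ seq x k → 1ℚ ℚ.≤ seq (x ^ n) k
1≤^ x k zero    1≤x = ℚ.≤-refl
1≤^ x k (suc n) 1≤x =
  let 0≤u-1 = p≤q⇒0≤q-p 1≤x
      0≤v-1 = p≤q⇒0≤q-p (1≤^ x k n 1≤x)
  in ≤-fromDiff (0≤p+q (0≤p*q 0≤u-1 0≤v-1) (0≤p+q 0≤u-1 0≤v-1))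
    (solve 2 (λ u v → (u :- con 1ℚ) :* (v :- con 1ℚ) :+ ((u :- con 1ℚ) :+ (v :- con 1ℚ)) := u :* v :- con 1ℚ)
      refl (seq x k) (seq (x ^ n) k))

-- An approximation of `x` is either at most 1, or at least 1 and hence at most its own power, which
-- is at most `1 + ε`.
^-cancel-≤1 : ∀ x n .{{_ : NonZero n}} → x ^ n ≤ 1ℝ → x ≤ 1ℝ
^-cancel-≤1 x (suc n) x^n≤1 ε 0<ε with x^n≤1 ε 0<ε
... | N , h = N , λ k p → bound k (h k p)
  where
  bound : ∀ k → seq x k ℚ.* seq (x ^ n) k ℚ.≤ 1ℚ ℚ.+ ε → seq x k ℚ.≤ 1ℚ ℚ.+ ε
  bound k h with ℚ.≤-total (seq x k) 1ℚ
  ... | inj₁ x≤1 = ℚ.≤-trans x≤1 (≤+pos 1ℚ ε 0<ε)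
  ... | inj₂ 1≤x = ℚ.≤-trans
    (≤-fromDiff
      (0≤p*q (ℚ.≤-trans (ℚ.<⇒≤ (ℚ.positive⁻¹ 1ℚ)) 1≤x) (p≤q⇒0≤q-p (1≤^ x k n 1≤x)))
      (solve 2 (λ u v → u :* (v :- con 1ℚ) := u :* v :- u) refl (seq x k) (seq (x ^ n) k)))
    h

-- Bernoulli's inequality, used to turn a gap below 1 for a power into a gap for its base.
bernoulli : ∀ x k → 0ℚ ℚ.≤ seq x k → seq x k ℚ.≤ 1ℚ →
  ∀ n → 1ℚ ℚ.≤ seq (x ^ n) k ℚ.+ + n ℚ./ 1 ℚ.* (1ℚ ℚ.- seq x k)
bernoulli x k 0≤u u≤1 zero = ℚ.≤-reflexive
  (solve 1 (λ u → con 1ℚ := con 1ℚ :+ con 0ℚ :* (con 1ℚ :- u)) refl (seq x k))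
bernoulli x k 0≤u u≤1 (suc n) =
  let u = seq x k ; v = seq (x ^ n) k ; m = + n ℚ./ 1
      0≤1-u = p≤q⇒0≤q-p u≤1
      0≤m = 0≤fromℕ n
      0≤ih = p≤q⇒0≤q-p (bernoulli x k 0≤u u≤1 n)
  in subst (λ m′ → 1ℚ ℚ.≤ u ℚ.* v ℚ.+ m′ ℚ.* (1ℚ ℚ.- u)) (sym (fromℕ-suc n))
       -- The difference of the two sides is `u` times that of the induction hypothesis, plus
       -- `m * (1 - u) * (1 - u)`.
       (≤-fromDiff (0≤p+q (0≤p*q 0≤u 0≤ih) (0≤p*q (0≤p*q 0≤m 0≤1-u) 0≤1-u))
         (solve 3 (λ u v m →
             u :* (v :+ m :* (con 1ℚ :- u) :- con 1ℚ) :+ m :* (con 1ℚ :- u) :* (con 1ℚ :- u)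
               := u :* v :+ (con 1ℚ :+ m) :* (con 1ℚ :- u) :- con 1ℚ)
           refl u v m))

-- A strict inequality needs one rational gap valid at all late indices. Where the approximation `u`
-- of `x` lies in the unit interval, Bernoulli gives `δ ≤ n * (1 - u)`, which bounds `1 - u` from
-- below.
^-cancel-<1 : ∀ x n → x ^ n < 1ℝ → x < 1ℝ
^-cancel-<1 x n (δ , 0<δ , N , h) = c , 0<c , N , λ k p → bound k (h k p)
  where
  -- The minimum with 1 gives `c ≤ 1`, which settles approximations that are at most 0; dividing by
  -- `n + 1` keeps the denominator positive when `n` is 0.
  M c : ℚ
  M = + suc n ℚ./ 1
  c = (δ ℚ.⊓ 1ℚ) ℚ.* recip M

  0<⊓ : 0ℚ ℚ.< δ ℚ.⊓ 1ℚ
  0<⊓ with ℚ.⊓-sel δ 1ℚ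
  ... | inj₁ eq = subst (0ℚ ℚ.<_) (sym eq) 0<δ
  ... | inj₂ eq = subst (0ℚ ℚ.<_) (sym eq) (ℚ.positive⁻¹ 1ℚ)

  1≤M : 1ℚ ℚ.≤ M
  1≤M = fromℕ-mono-≤ (ℕ.s≤s (ℕ.z≤n {n}))

  0<M : 0ℚ ℚ.< M
  0<M = ℚ.<-≤-trans (ℚ.positive⁻¹ 1ℚ) 1≤M

  0<c : 0ℚ ℚ.< c
  0<c = 0<* {δ ℚ.⊓ 1ℚ} {recip M} 0<⊓ (recip-pos 0<M)

  cM≡ : c ℚ.* M ≡ δ ℚ.⊓ 1ℚ
  cM≡ = recip-cancelʳ (δ ℚ.⊓ 1ℚ) 0<M

  c≤1 : c ℚ.≤ 1ℚ
  c≤1 = ℚ.≤-trans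
    (≤-fromDiff (0≤p*q (ℚ.<⇒≤ 0<c) (p≤q⇒0≤q-p 1≤M))
      (solve 2 (λ c M → c :* (M :- con 1ℚ) := c :* M :- c) refl c M))
    (subst (ℚ._≤ 1ℚ) (sym cM≡) (ℚ.p⊓q≤q δ 1ℚ))

  bound : ∀ k → seq (x ^ n) k ℚ.+ δ ℚ.≤ 1ℚ → seq x k ℚ.+ c ℚ.≤ 1ℚ
  bound k h with ℚ.≤-total (seq x k) 0ℚ | ℚ.≤-total (seq x k) 1ℚ
  ... | inj₁ x≤0 | _ = ℚ.+-mono-≤ x≤0 c≤1
  ... | inj₂ 0≤x | inj₂ 1≤x = ⊥-elim (ℚ.<-irrefl refl (ℚ.<-≤-trans
    (subst (ℚ._< 1ℚ ℚ.+ δ) (ℚ.+-identityʳ 1ℚ) (ℚ.+-monoʳ-< 1ℚ 0<δ))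
    (ℚ.≤-trans (ℚ.+-monoˡ-≤ δ (1≤^ x k n 1≤x)) h)))
  ... | inj₂ 0≤x | inj₁ x≤1 = ≤-fromDiff (p≤q⇒0≤q-p c≤1-u)
    (solve 2 (λ u c → (con 1ℚ :- u) :- c := con 1ℚ :- (u :+ c)) refl u c)
    where
    u v m : ℚ
    u = seq x k
    v = seq (x ^ n) k
    m = + n ℚ./ 1

    δ≤ : δ ℚ.≤ (1ℚ ℚ.- u) ℚ.* M
    δ≤ = subst (λ M → δ ℚ.≤ (1ℚ ℚ.- u) ℚ.* M) (sym (fromℕ-suc n))
      (≤-fromDiff
        (0≤p+q (p≤q⇒0≤q-p h) (0≤p+q (p≤q⇒0≤q-p (bernoulli x k 0≤x x≤1 n)) (p≤q⇒0≤q-p x≤1)))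
        (solve 4 (λ u v m δ →
            (con 1ℚ :- (v :+ δ)) :+ ((v :+ m :* (con 1ℚ :- u) :- con 1ℚ) :+ (con 1ℚ :- u))
              := (con 1ℚ :- u) :* (con 1ℚ :+ m) :- δ)
          refl u v m δ))

    c≤1-u : c ℚ.≤ 1ℚ ℚ.- u
    c≤1-u = ℚ.*-cancelʳ-≤-pos M {{ℚ.positive 0<M}}
      (ℚ.≤-trans (ℚ.≤-reflexive cM≡) (ℚ.≤-trans (ℚ.p⊓q≤p δ 1ℚ) δ≤))

-- Cancelling a positive factor, and inverses.

*-cancelˡ-<1 : ∀ c x → 0ℚ ℚ.< c → fromℚ c * x < fromℚ c → x < 1ℝ
*-cancelˡ-<1 c x 0<c (δ , 0<δ , N , h) =
  δ ℚ.* recip c , 0<* {δ} {recip c} 0<δ (recip-pos 0<c) , N , λ k p →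
    ℚ.*-cancelʳ-≤-pos c {{ℚ.positive 0<c}} (begin
      (seq x k ℚ.+ δ ℚ.* recip c) ℚ.* c          ≡⟨ ℚ.*-distribʳ-+ c (seq x k) (δ ℚ.* recip c) ⟩
      seq x k ℚ.* c ℚ.+ δ ℚ.* recip c ℚ.* c      ≡⟨ cong₂ ℚ._+_ (ℚ.*-comm (seq x k) c) (recip-cancelʳ δ 0<c) ⟩
      c ℚ.* seq x k ℚ.+ δ                        ≤⟨ h k p ⟩
      c                                          ≡⟨ ℚ.*-identityˡ c ⟨
      1ℚ ℚ.* c                                   ∎)
  where open ℚ.≤-Reasoning

⁻¹-nonNeg : ∀ x (0<x : 0ℝ < x) → 0ℝ ≤ x ⁻¹[ 0<x ]
⁻¹-nonNeg x 0<x@(δ , 0<δ , N , h) = eventually-≤ 0ℝ (x ⁻¹[ 0<x ]) N λ k p →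
  ℚ.<⇒≤ (recip-pos (ℚ.<-≤-trans 0<δ (subst (ℚ._≤ seq x k) (ℚ.+-identityˡ δ) (h k p))))

-- From index `N` on the approximations of `x` are at least `δ`, so the default value of `recip` at
-- 0 can occur only at earlier indices.
⁻¹-inverseˡ-≥ : ∀ x (0<x : 0ℝ < x) → 1ℝ ≤ x ⁻¹[ 0<x ] * x
⁻¹-inverseˡ-≥ x 0<x@(δ , 0<δ , N , h) = eventually-≤ 1ℝ (x ⁻¹[ 0<x ] * x) N λ k p →
  ℚ.≤-reflexive (sym (recip-inverse
    (ℚ.<-≤-trans 0<δ (subst (ℚ._≤ seq x k) (ℚ.+-identityˡ δ) (h k p)))))

≃⇒≤ : ∀ x y → x ≃ y → x ≤ y
≃⇒≤ x y x≃y ε 0<ε with x≃y ε 0<ε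
... | N , h = N , λ k p →
  ≤-fromDiff (p≤q⇒0≤q-p (ℚ.≤-trans (p≤∣p∣ (seq x k ℚ.- seq y k)) (ℚ.<⇒≤ (h k p))))
    (solve 3 (λ x y ε → ε :- (x :- y) := y :+ ε :- x) refl (seq x k) (seq y k) ε)

x≤∣x∣ : ∀ x → x ≤ ∣ x ∣
x≤∣x∣ x = pointwise-≤ x ∣ x ∣ λ k → p≤∣p∣ (seq x k)

-- Minimal elements and truncated covers.

private variable
  m : ℕ

-- Descent on cardinality: as `𝓕` is Boolean-valued, it is decidable whether a proper subset of `A`
-- lies in `𝓕`; if none does, `A` is itself minimal.
minimal-below : ∀ (𝓕 : Family m) A → A ∈ 𝓕 → ∃[ S ] IsMinimalIn 𝓕 S × S ⊆ A
minimal-below {m} 𝓕 A = <-rec P step ∥ A ∥ A refl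
  where
  P : ℕ → Set
  P k = ∀ A → ∥ A ∥ ≡ k → A ∈ 𝓕 → ∃[ S ] IsMinimalIn 𝓕 S × S ⊆ A

  step : ∀ k → (∀ {j} → j ℕ.< k → P j) → P k
  step _ rec A refl A∈𝓕 with anySubset? (λ B → T? (𝓕 B) ×-dec B ⊂? A)
  ... | yes (B , B∈𝓕 , B⊂A) with rec (p⊂q⇒∣p∣<∣q∣ B⊂A) B refl B∈𝓕
  ...   | S , S-minimal , S⊆B = S , S-minimal , λ x∈S → proj₁ B⊂A (S⊆B x∈S)
  step _ rec A refl A∈𝓕 | no ∄B = A , (A∈𝓕 , minimal) , λ x∈A → x∈A
    where
    minimal : ∀ B → B ∈ 𝓕 → B ⊆ A → B ≡ A
    minimal B B∈𝓕 B⊆A with any? (λ x → x ∈? A ×-dec ¬? (x ∈? B))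
    ... | yes (x , x∈A∖B) = ⊥-elim (∄B (B , B∈𝓕 , B⊆A , x , x∈A∖B))
    ... | no ∄x = ⊆-antisym B⊆A λ {x} x∈A →
      decidable-stable (x ∈? B) λ x∉B → ∄x (x , x∈A , x∉B)

truncate : ℕ → Family m → Family m
truncate n 𝓖 S = 𝓖 S ∧ (∥ S ∥ ℕ.≤ᵇ n)

truncate-covers : ∀ (𝓕 𝓖 : Family m) n → (∀ S → IsMinimalIn 𝓕 S → ∥ S ∥ ℕ.≤ n) →
  𝓖 Covers 𝓕 → truncate n 𝓖 Covers 𝓕
truncate-covers 𝓕 𝓖 n minimal≤n 𝓖-covers A A∈𝓕 =
  let M , M-minimal , M⊆A = minimal-below 𝓕 A A∈𝓕
      S , S∈𝓖 , S⊆M = 𝓖-covers M (proj₁ M-minimal)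
      ∣S∣≤n = ℕ.≤-trans (p⊆q⇒∣p∣≤∣q∣ S⊆M) (minimal≤n M M-minimal)
  in S , Equivalence.from T-∧ (S∈𝓖 , ℕ.≤⇒≤ᵇ ∣S∣≤n) , λ x∈S → M⊆A (S⊆M x∈S)

∅∈subsets : ∀ m → ∅ ∈ₗ subsets m
∅∈subsets zero    = here refl
∅∈subsets (suc m) = ∈-++⁺ˡ (∈-map⁺ (outside ∷_) (∅∈subsets m))

-- Weights of lists of sets.

-- The cost of a cover, on lists instead of families so that induction over lists and sublists
-- applies; on `members 𝓖` it unfolds to the sum in `_IsSmall_`.
weight : ℝ → List (Subset m) → ℝ
weight x = foldr (λ S acc → x ^ ∥ S ∥ + acc) 0ℝ

module _ (x : ℝ) (0≤x : 0ℝ ≤ x) where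

  weight-mono : {Ss Ts : List (Subset m)} → Ss ⊑ Ts → weight x Ss ≤ weight x Ts
  weight-mono []                           = ≤-refl 0ℝ
  weight-mono {Ss = Ss} {T ∷ Ts} (T ∷ʳ τ)  = begin
    weight x Ss                   ≲⟨ pointwise-≡ (weight x Ss) (0ℝ + weight x Ss) (λ k →
                                     sym (ℚ.+-identityˡ (seq (weight x Ss) k))) ⟩
    0ℝ + weight x Ss              ≲⟨ +-mono-≤ 0ℝ (x ^ ∥ T ∥) (weight x Ss) (weight x Ts)
                                     (^-nonNeg x ∥ T ∥ 0≤x) (weight-mono τ) ⟩
    x ^ ∥ T ∥ + weight x Ts       ∎
    where open ≤-Reasoning
  weight-mono {Ss = S ∷ Ss} {S ∷ Ts} (refl ∷ τ) = +-mono-≤ (x ^ ∥ S ∥) (x ^ ∥ S ∥)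
    (weight x Ss) (weight x Ts) (≤-refl (x ^ ∥ S ∥)) (weight-mono τ)

  length-*-≤weight : x ≤ 1ℝ → ∀ n {Ss : List (Subset m)} → All (λ S → ∥ S ∥ ℕ.≤ n) Ss →
    fromℕ (length Ss) * x ^ n ≤ weight x Ss
  length-*-≤weight x≤1 n [] = pointwise-≡ (fromℕ 0 * x ^ n) 0ℝ λ k → ℚ.*-zeroˡ (seq (x ^ n) k)
  length-*-≤weight x≤1 n {S ∷ Ss} (∣S∣≤n ∷ all) = begin
    fromℕ (suc c) * x ^ n        ≲⟨ pointwise-≡ (fromℕ (suc c) * x ^ n) (x ^ n + fromℕ c * x ^ n) suc-* ⟩
    x ^ n + fromℕ c * x ^ n      ≲⟨ +-mono-≤ (x ^ n) (x ^ ∥ S ∥) (fromℕ c * x ^ n) (weight x Ss)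
                                      (^-antitone x 0≤x x≤1 ∣S∣≤n) (length-*-≤weight x≤1 n all) ⟩
    x ^ ∥ S ∥ + weight x Ss        ∎
    where
    open ≤-Reasoning
    c = length Ss
    suc-* : ∀ k → + suc c ℚ./ 1 ℚ.* seq (x ^ n) k ≡ seq (x ^ n) k ℚ.+ + c ℚ./ 1 ℚ.* seq (x ^ n) k
    suc-* k = trans (cong (ℚ._* seq (x ^ n) k) (fromℕ-suc c))
      (solve 2 (λ c v → (con 1ℚ :+ c) :* v := v :+ c :* v) refl (+ c ℚ./ 1) (seq (x ^ n) k))

  -- The one-element list of `∅` is a sublist and already has weight `x ^ 0`.
  1≤weight : {Ss : List (Subset m)} → ∅ ∈ₗ Ss → 1ℝ ≤ weight x Ss
  1≤weight {m} {Ss} ∅∈Ss = begin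
    1ℝ                     ≲⟨ pointwise-≡ 1ℝ (1ℝ + 0ℝ) (λ _ → sym (ℚ.+-identityʳ 1ℚ)) ⟩
    1ℝ + 0ℝ                ≲⟨ pointwise-≡ (1ℝ + 0ℝ) (weight x (∅ {m} ∷ [])) (λ k →
                                cong (λ j → seq (x ^ j) k ℚ.+ 0ℚ) (sym (∣⊥∣≡0 m))) ⟩
    weight x (∅ {m} ∷ [])    ≲⟨ weight-mono (from∈ ∅∈Ss) ⟩
    weight x Ss              ∎
    where open ≤-Reasoning

-- Expectation threshold against covering dimension.

1≰½ : ¬ 1ℝ ≤ ½ℝ
-- Slack one quarter would give 1 ≤ 3/4, which is refuted by computation.
1≰½ 1≤½ with 1≤½ (½ ℚ.* ½) (0<½* (ℚ.positive⁻¹ ½))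
... | N , h = toWitnessFalse {a? = 1ℚ ℚ.≤? ½ ℚ.+ ½ ℚ.* ½} _ (h N ℕ.≤-refl)

-- The threshold is attained, so a cover `𝓖` of cost at most one half exists at `q` itself. Its
-- truncation `𝓗` competes in the minimum defining the dimension, hence has at least `d` members.
threshold-bound : ∀ (𝓕 : Family m) q d n → IsExpectationThreshold 𝓕 q → IsCoveringDimension 𝓕 d →
  (∀ S → IsMinimalIn 𝓕 S → ∥ S ∥ ℕ.≤ n) → q ^ n * fromℕ d ≤ ½ℝ
threshold-bound {m} 𝓕 q d n (((0≤q , q≤1) , 𝓖 , 𝓖-covers , ∑≤½) , _) (_ , d-least) minimal≤n = begin
  q ^ n * fromℕ d            ≲⟨ *-monoˡ-≤ (q ^ n) (fromℕ d) (fromℕ (card 𝓗)) (^-nonNeg q n 0≤q)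
                                  (fromℚ-mono-≤ (fromℕ-mono-≤ d≤card)) ⟩
  q ^ n * fromℕ (card 𝓗)     ≲⟨ *-comm-≤ (q ^ n) (fromℕ (card 𝓗)) ⟩
  fromℕ (card 𝓗) * q ^ n     ≲⟨ length-*-≤weight q 0≤q q≤1 n
                                  (All.map (λ {S} → 𝓗≤n {S}) (all-filter (λ S → T? (𝓗 S)) (subsets m))) ⟩
  -- Both families filter the same enumeration of subsets, so the members of `𝓗` form a sublist of
  -- those of `𝓖`.
  weight q (members 𝓗)   ≲⟨ weight-mono q 0≤q
                                  (filter⁺ (λ S → T? (𝓗 S)) (λ S → T? (𝓖 S)) (λ { refl → 𝓗⊆𝓖 }) (⊑-refl {x = subsets m})) ⟩
  ∑ 𝓖 (λ S → q ^ ∥ S ∥)      ≲⟨ ∑≤½ ⟩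
  ½ℝ                         ∎
  where
  open ≤-Reasoning

  𝓗 : Family m
  𝓗 = truncate n 𝓖

  𝓗⊆𝓖 : ∀ {S} → S ∈ 𝓗 → S ∈ 𝓖
  𝓗⊆𝓖 S∈𝓗 = proj₁ (Equivalence.to T-∧ S∈𝓗)

  𝓗≤n : ∀ {S} → S ∈ 𝓗 → ∥ S ∥ ℕ.≤ n
  𝓗≤n {S} S∈𝓗 = ℕ.≤ᵇ⇒≤ ∥ S ∥ n (proj₂ (Equivalence.to (T-∧ {𝓖 S}) S∈𝓗))

  ∅∉𝓖 : ∅ ∉ 𝓖
  ∅∉𝓖 ∅∈𝓖 = 1≰½ (≤-trans 1ℝ (∑ 𝓖 (λ S → q ^ ∥ S ∥)) ½ℝ
    (1≤weight q 0≤q (∈-filter⁺ (λ S → T? (𝓖 S)) (∅∈subsets m) ∅∈𝓖)) ∑≤½)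

  proper : ¬ (∀ A → A ∈⟨ 𝓗 ⟩)
  -- A member of `𝓗` contained in `∅` would be `∅` itself, which is not in `𝓖`.
  proper all with all ∅
  ... | S , S∈𝓗 , S⊆∅ = ∅∉𝓖 (subst (_∈ 𝓖) (⊆-antisym S⊆∅ ⊥⊆) (𝓗⊆𝓖 S∈𝓗))

  d≤card : d ℕ.≤ card 𝓗
  d≤card = d-least (card 𝓗) (𝓗 , truncate-covers 𝓕 𝓖 n minimal≤n 𝓖-covers , proper , refl)

-- Consequences of the bound for a single upper set.

-- With `t = K * L`, the two bounds give `d * (t * q) ^ n ≤ ½ * t ^ n < d`; cancelling `d` and then
-- the exponent leaves `t * q < 1`.
product-<1 : ∀ K q L d n → 0ℝ ≤ K → 0ℝ ≤ L →
  q ^ n * fromℕ d ≤ ½ℝ → ½ℝ * (K * L) ^ n < fromℕ d → K * q * L < 1ℝ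
product-<1 K q L d n 0≤K 0≤L q^nd≤½ ½t^n<d =
  ≤-<-trans (K * q * L) (t * q) 1ℝ
    (pointwise-≡ (K * q * L) (t * q) λ k →
      solve 3 (λ K q L → K :* q :* L := K :* L :* q) refl (seq K k) (seq q k) (seq L k))
    (^-cancel-<1 (t * q) n
      (*-cancelˡ-<1 (+ d ℚ./ 1) ((t * q) ^ n) 0<d
        (≤-<-trans (D * (t * q) ^ n) (½ℝ * t ^ n) D bound ½t^n<d)))
  where
  t D : ℝ
  t = K * L
  D = fromℕ d

  0≤t^n : 0ℝ ≤ t ^ n
  0≤t^n = ^-nonNeg t n (*-nonNeg K L 0≤K 0≤L)

  -- Positivity of `d` comes from the strict hypothesis, whose left side is nonnegative.
  0<d : 0ℚ ℚ.< + d ℚ./ 1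
  0<d = fromℚ-cancel-< (≤-<-trans 0ℝ (½ℝ * t ^ n) D
    (*-nonNeg ½ℝ (t ^ n) (fromℚ-mono-≤ (ℚ.<⇒≤ (ℚ.positive⁻¹ ½))) 0≤t^n) ½t^n<d)

  bound : D * (t * q) ^ n ≤ ½ℝ * t ^ n
  bound = begin
    D * (t * q) ^ n        ≲⟨ pointwise-≡ (D * (t * q) ^ n) (t ^ n * (q ^ n * D)) (λ k → trans
                                (cong (+ d ℚ./ 1 ℚ.*_) (^-distribʳ-* t q n k))
                                (solve 3 (λ D u v → D :* (u :* v) := u :* (v :* D))
                                  refl (+ d ℚ./ 1) (seq (t ^ n) k) (seq (q ^ n) k))) ⟩
    t ^ n * (q ^ n * D)    ≲⟨ *-monoˡ-≤ (t ^ n) (q ^ n * D) ½ℝ 0≤t^n q^nd≤½ ⟩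
    t ^ n * ½ℝ             ≲⟨ *-comm-≤ (t ^ n) ½ℝ ⟩
    ½ℝ * t ^ n             ∎
    where open ≤-Reasoning

-- The power `(q * r) ^ n` is at most `q ^ n * 2d`, twice a quantity bounded by one half.
product-≤1 : ∀ q r d n .{{_ : NonZero n}} → 0ℝ ≤ q →
  q ^ n * fromℕ d ≤ ½ℝ → r ^ n ≃ fromℕ (2 ℕ.* d) → q * r ≤ 1ℝ
product-≤1 q r d n 0≤q q^nd≤½ r^n≃2d = ^-cancel-≤1 (q * r) n (begin
  (q * r) ^ n                            ≲⟨ pointwise-≡ ((q * r) ^ n) (q ^ n * r ^ n) (^-distribʳ-* q r n) ⟩
  q ^ n * r ^ n                          ≲⟨ *-monoˡ-≤ (q ^ n) (r ^ n) (fromℕ (2 ℕ.* d)) (^-nonNeg q n 0≤q)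
                                              (≃⇒≤ (r ^ n) (fromℕ (2 ℕ.* d)) r^n≃2d) ⟩
  q ^ n * fromℕ (2 ℕ.* d)                ≲⟨ pointwise-≡ (q ^ n * fromℕ (2 ℕ.* d)) (q ^ n * D + q ^ n * D) double ⟩
  q ^ n * D + q ^ n * D                  ≲⟨ +-mono-≤ (q ^ n * D) ½ℝ (q ^ n * D) ½ℝ q^nd≤½ q^nd≤½ ⟩
  ½ℝ + ½ℝ                                ≲⟨ pointwise-≡ (½ℝ + ½ℝ) 1ℝ (λ _ → refl) ⟩
  1ℝ                                     ∎)
  where
  open ≤-Reasoning
  D = fromℕ d
  double : ∀ k → seq (q ^ n) k ℚ.* (+ (2 ℕ.* d) ℚ./ 1) ≡
                 seq (q ^ n) k ℚ.* (+ d ℚ./ 1) ℚ.+ seq (q ^ n) k ℚ.* (+ d ℚ./ 1)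
  double k = trans
    (cong (seq (q ^ n) k ℚ.*_)
      (trans (cong (λ j → + (d ℕ.+ j) ℚ./ 1) (ℕ.+-identityʳ d)) (fromℕ-+ d d)))
    (ℚ.*-distribˡ-+ (seq (q ^ n) k) (+ d ℚ./ 1) (+ d ℚ./ 1))

-- This dominates `q log ℓ` by the quotient whose limit is 0 under (ii): insert `s * r`, regroup,
-- and use `q * r ≤ 1`.
*-≤-quotient : ∀ q L r (0<r : 0ℝ < r) → 0ℝ ≤ q → 0ℝ ≤ L → q * r ≤ 1ℝ → q * L ≤ L * r ⁻¹[ 0<r ]
*-≤-quotient q L r 0<r 0≤q 0≤L qr≤1 = begin
  q * L                   ≲⟨ *-identityʳ-≥ (q * L) ⟩
  q * L * 1ℝ              ≲⟨ *-monoˡ-≤ (q * L) 1ℝ (s * r) (*-nonNeg q L 0≤q 0≤L) (⁻¹-inverseˡ-≥ r 0<r) ⟩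
  q * L * (s * r)         ≲⟨ pointwise-≡ (q * L * (s * r)) (L * s * (q * r)) (λ k →
                               solve 4 (λ q L s r → q :* L :* (s :* r) := L :* s :* (q :* r))
                                 refl (seq q k) (seq L k) (seq s k) (seq r k)) ⟩
  L * s * (q * r)         ≲⟨ *-monoˡ-≤ (L * s) (q * r) 1ℝ (*-nonNeg L s 0≤L (⁻¹-nonNeg r 0<r)) qr≤1 ⟩
  L * s * 1ℝ              ≲⟨ *-identityʳ-≤ (L * s) ⟩
  L * s                   ∎
  where
  open ≤-Reasoning
  s = r ⁻¹[ 0<r ]

-- Passage to the limit.

-- The bound by half of `e` leaves the other half for the slack in `_≤_`.
eventually-∣∣≤ : ∀ x {e} → 0ℚ ℚ.< e → 0ℝ ≤ x → x ≤ fromℚ (½ ℚ.* e) →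
  ∃[ N ] ∀ k → N ℕ.≤ k → ℚ.∣ seq x k ∣ ℚ.≤ e
eventually-∣∣≤ x {e} 0<e 0≤x x≤½e with 0≤x e 0<e | x≤½e (½ ℚ.* e) (0<½* 0<e)
... | N , h | M , h′ = N ⊔ M , λ k p → ∣p∣≤
  (subst (seq x k ℚ.≤_) (½ε+½ε≡ε e) (h′ k (ℕ.m⊔n≤o⇒n≤o N M p)))
  (h k (ℕ.m⊔n≤o⇒m≤o N M p))

log₂-≥1 : ∀ ℓ .{{_ : NonZero ℓ}} → 2 ℕ.≤ ℓ → 1ℝ ≤ log₂ ℓ
log₂-≥1 ℓ 2≤ℓ = log₂-≥ ℓ 1 0 (ℕ.^-monoˡ-≤ 1 2≤ℓ)

-- The quantity is at most `∣K∣ * (q * L) + q` in absolute value, and since `L` is at least 1, both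
-- `q` and `q * L` are dominated by `a`.
perfect-information : ∀ K (q L a : ℕ → ℝ) →
  (∀ n → 0ℝ ≤ q n) → (∀ n → 1ℝ ≤ L n) → (∀ n → q n * L n ≤ a n) → a ⟶ 0ℝ →
  AsymptoticallyPerfectInformation K q L
perfect-information K q L a 0≤q 1≤L qL≤a a⟶0 ε (ε₀ , 0<ε₀ , N₀ , ε₀≤ε) =
  let N , close = a⟶0 (fromℚ (½ ℚ.* e)) 0<½e in N , λ n p → small n (close n p)
  where
  B : ℚ
  B = proj₁ (bounded K)

  0<1+B : 0ℚ ℚ.< 1ℚ ℚ.+ B
  0<1+B = ℚ.+-mono-< (ℚ.positive⁻¹ 1ℚ) (proj₁ (proj₂ (bounded K)))

  -- Chosen so that `B * e + e` is half of `ε₀`; the other half is the gap required by the strict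
  -- inequality.
  e : ℚ
  e = ½ ℚ.* ε₀ ℚ.* recip (1ℚ ℚ.+ B)

  0<e : 0ℚ ℚ.< e
  0<e = 0<* {½ ℚ.* ε₀} {recip (1ℚ ℚ.+ B)} (0<½* 0<ε₀) (recip-pos 0<1+B)

  0<½e : 0ℝ < fromℚ (½ ℚ.* e)
  0<½e = ½ ℚ.* e , 0<½* 0<e , 0 , λ _ _ → ℚ.≤-reflexive (ℚ.+-identityˡ (½ ℚ.* e))

  small : ∀ n → ∣ a n - 0ℝ ∣ < fromℚ (½ ℚ.* e) → ∣ (K * L n - 1ℝ) * q n - 0ℝ ∣ < ε
  small n close =
    -- The term `n` is now fixed; the remaining bounds concern the index `k` of rational
    -- approximations.
    let N₁ , hK = proj₂ (proj₂ (bounded K))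
        N₂ , hq = eventually-∣∣≤ (q n) 0<e (0≤q n) q≤
        N₃ , hqL = eventually-∣∣≤ (q n * L n) 0<e 0≤qL qL≤
    in ½ ℚ.* ε₀ , 0<½* 0<ε₀ , (N₀ ⊔ N₁) ⊔ (N₂ ⊔ N₃) , λ k p →
      let p₀₁ = ℕ.m⊔n≤o⇒m≤o (N₀ ⊔ N₁) (N₂ ⊔ N₃) p
          p₂₃ = ℕ.m⊔n≤o⇒n≤o (N₀ ⊔ N₁) (N₂ ⊔ N₃) p
      in pointwise k (ε₀≤ε k (ℕ.m⊔n≤o⇒m≤o N₀ N₁ p₀₁)) (hK k (ℕ.m⊔n≤o⇒n≤o N₀ N₁ p₀₁))
           (hq k (ℕ.m⊔n≤o⇒m≤o N₂ N₃ p₂₃)) (hqL k (ℕ.m⊔n≤o⇒n≤o N₂ N₃ p₂₃))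
    where
    0≤L : 0ℝ ≤ L n
    0≤L = ≤-trans 0ℝ 1ℝ (L n) 0≤1 (1≤L n)

    0≤qL : 0ℝ ≤ q n * L n
    0≤qL = *-nonNeg (q n) (L n) (0≤q n) 0≤L

    qL≤ : q n * L n ≤ fromℚ (½ ℚ.* e)
    qL≤ = begin
      q n * L n             ≲⟨ qL≤a n ⟩
      a n                   ≲⟨ pointwise-≡ (a n) (a n - 0ℝ) (λ k → sym (ℚ.+-identityʳ (seq (a n) k))) ⟩
      a n - 0ℝ              ≲⟨ x≤∣x∣ (a n - 0ℝ) ⟩
      ∣ a n - 0ℝ ∣          ≲⟨ <⇒≤ ∣ a n - 0ℝ ∣ (fromℚ (½ ℚ.* e)) close ⟩
      fromℚ (½ ℚ.* e)       ∎
      where open ≤-Reasoning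

    q≤ : q n ≤ fromℚ (½ ℚ.* e)
    q≤ = begin
      q n                   ≲⟨ *-identityʳ-≥ (q n) ⟩
      q n * 1ℝ              ≲⟨ *-monoˡ-≤ (q n) 1ℝ (L n) (0≤q n) (1≤L n) ⟩
      q n * L n             ≲⟨ qL≤ ⟩
      fromℚ (½ ℚ.* e)       ∎
      where open ≤-Reasoning

    pointwise : ∀ k → let κ = seq K k ; u = seq (q n) k ; l = seq (L n) k in
      0ℚ ℚ.+ ε₀ ℚ.≤ seq ε k → ℚ.∣ κ ∣ ℚ.≤ B → ℚ.∣ u ∣ ℚ.≤ e → ℚ.∣ u ℚ.* l ∣ ℚ.≤ e →
      ℚ.∣ (κ ℚ.* l ℚ.- 1ℚ) ℚ.* u ℚ.- 0ℚ ∣ ℚ.+ ½ ℚ.* ε₀ ℚ.≤ seq ε k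
    pointwise k ε₀≤ κ≤B u≤e ul≤e = begin
      ℚ.∣ (κ ℚ.* l ℚ.- 1ℚ) ℚ.* u ℚ.- 0ℚ ∣ ℚ.+ ½ ℚ.* ε₀
        ≡⟨ cong (λ z → ℚ.∣ z ∣ ℚ.+ ½ ℚ.* ε₀)
             (solve 3 (λ κ u l → (κ :* l :- con 1ℚ) :* u :- con 0ℚ := κ :* (u :* l) :+ (:- u)) refl κ u l) ⟩
      ℚ.∣ κ ℚ.* (u ℚ.* l) ℚ.+ ℚ.- u ∣ ℚ.+ ½ ℚ.* ε₀
        ≤⟨ ℚ.+-monoˡ-≤ (½ ℚ.* ε₀) (ℚ.∣p+q∣≤∣p∣+∣q∣ (κ ℚ.* (u ℚ.* l)) (ℚ.- u)) ⟩
      ℚ.∣ κ ℚ.* (u ℚ.* l) ∣ ℚ.+ ℚ.∣ ℚ.- u ∣ ℚ.+ ½ ℚ.* ε₀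
        ≡⟨ cong₂ (λ y z → y ℚ.+ z ℚ.+ ½ ℚ.* ε₀) (ℚ.∣p*q∣≡∣p∣*∣q∣ κ (u ℚ.* l)) (ℚ.∣-p∣≡∣p∣ u) ⟩
      ℚ.∣ κ ∣ ℚ.* ℚ.∣ u ℚ.* l ∣ ℚ.+ ℚ.∣ u ∣ ℚ.+ ½ ℚ.* ε₀
        ≤⟨ ℚ.+-monoˡ-≤ (½ ℚ.* ε₀) (ℚ.+-mono-≤ κul≤Be u≤e) ⟩
      B ℚ.* e ℚ.+ e ℚ.+ ½ ℚ.* ε₀
        ≡⟨ cong (ℚ._+ ½ ℚ.* ε₀) (trans
             (solve 2 (λ B e → B :* e :+ e := e :* (con 1ℚ :+ B)) refl B e)
             (recip-cancelʳ (½ ℚ.* ε₀) 0<1+B)) ⟩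
      ½ ℚ.* ε₀ ℚ.+ ½ ℚ.* ε₀
        ≡⟨ ½ε+½ε≡ε ε₀ ⟩
      ε₀
        ≡⟨ ℚ.+-identityˡ ε₀ ⟨
      0ℚ ℚ.+ ε₀
        ≤⟨ ε₀≤ ⟩
      seq ε k ∎
      where
      open ℚ.≤-Reasoning
      κ = seq K k
      u = seq (q n) k
      l = seq (L n) k
      κul≤Be : ℚ.∣ κ ∣ ℚ.* ℚ.∣ u ℚ.* l ∣ ℚ.≤ B ℚ.* e
      κul≤Be = ℚ.≤-trans
        (ℚ.*-monoʳ-≤-nonNeg ℚ.∣ u ℚ.* l ∣ {{ℚ.∣-∣-nonNeg (u ℚ.* l)}} κ≤B)
        (ℚ.*-monoˡ-≤-nonNeg B {{ℚ.nonNegative (ℚ.<⇒≤ (proj₁ (proj₂ (bounded K))))}} ul≤e)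

-- Assembly for a sequence of upper sets.

mainTheorem5 :
  (size : ℕ → ℕ) (𝓕 : ∀ n → Family (size n)) →
  (∀ n → IsUpperSet (𝓕 n)) →
  (∀ n → Nontrivial (𝓕 n)) →
  (p-c q : ℕ → ℝ) (dim ℓ₀ : ℕ → ℕ) →
  (∀ n → IsCriticalProbability (𝓕 n) (p-c n)) →
  (∀ n → IsExpectationThreshold (𝓕 n) (q n)) →
  (∀ n → IsCoveringDimension (𝓕 n) (dim n)) →
  (∀ n → Isℓ₀ (𝓕 n) (ℓ₀ n)) →
  let ℓ : ℕ → ℕ
      ℓ n = ℓ₀ n ⊔ 2
      logℓ : ℕ → ℝ
      logℓ n = log₂ (ℓ n)
  in
  (K : ℝ) → 0ℝ < K →
  (∀ n → p-c n ≤ K * q n * logℓ n) →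
  (Eventually (λ n → ½ℝ * (K * logℓ n) ^ ℓ n < fromℕ (dim n)) →
    NontrivialInformation K q logℓ)
  ×
  ((r : ℕ → ℝ) (root : ∀ n → IsPositiveRoot (ℓ n) (fromℕ (2 ℕ.* dim n)) (r n)) →
    logℓ ≪ r [ (λ n → proj₁ (root n)) ] →
    AsymptoticallyPerfectInformation K q logℓ)
mainTheorem5 size 𝓕 _ _ _ q dim ℓ₀ _ q-threshold dim-minimum ℓ₀-maximum K 0<K _ = nontrivial , perfect
  where
  0≤q : ∀ n → 0ℝ ≤ q n
  0≤q n = proj₁ (proj₁ (proj₁ (q-threshold n)))

  -- The maximum with 2 in `ℓ` makes the logarithm at least 1, so that `q` is at most `q log ℓ`.
  1≤logℓ : ∀ n → 1ℝ ≤ log₂ (ℓ₀ n ⊔ 2)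
  1≤logℓ n = log₂-≥1 (ℓ₀ n ⊔ 2) (ℕ.m≤n⊔m (ℓ₀ n) 2)

  0≤logℓ : ∀ n → 0ℝ ≤ log₂ (ℓ₀ n ⊔ 2)
  0≤logℓ n = ≤-trans 0ℝ 1ℝ (log₂ (ℓ₀ n ⊔ 2)) 0≤1 (1≤logℓ n)

  q^ℓ*dim≤½ : ∀ n → q n ^ (ℓ₀ n ⊔ 2) * fromℕ (dim n) ≤ ½ℝ
  q^ℓ*dim≤½ n = threshold-bound (𝓕 n) (q n) (dim n) (ℓ₀ n ⊔ 2) (q-threshold n) (dim-minimum n) λ S S-minimal →
    ℕ.≤-trans (proj₂ (ℓ₀-maximum n) ∥ S ∥ (S , S-minimal , refl)) (ℕ.m≤m⊔n (ℓ₀ n) 2)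

  -- The instance is n⊔2≢0 unfolded: it makes the type of h syntactically equal
  -- to the expected one, which spares the comparison of the Cauchy moduli.
  nontrivial : Eventually (λ n → ½ℝ * (K * log₂ (ℓ₀ n ⊔ 2)) ^ (ℓ₀ n ⊔ 2) < fromℕ (dim n)) →
    NontrivialInformation K q (λ n → log₂ (ℓ₀ n ⊔ 2))
  nontrivial (N , h) = N , λ n p → product-<1 K (q n)
    (log₂ (ℓ₀ n ⊔ 2) {{ℕ.>-nonZero (ℕ.≤-trans (ℕ.s≤s ℕ.z≤n) (ℕ.m≤n⊔m (ℓ₀ n) 2))}})
    (dim n) (ℓ₀ n ⊔ 2) (<⇒≤ 0ℝ K 0<K) (0≤logℓ n) (q^ℓ*dim≤½ n) (h n p)

  perfect : (r : ℕ → ℝ) (root : ∀ n → IsPositiveRoot (ℓ₀ n ⊔ 2) (fromℕ (2 ℕ.* dim n)) (r n)) →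
    (λ n → log₂ (ℓ₀ n ⊔ 2)) ≪ r [ (λ n → proj₁ (root n)) ] →
    AsymptoticallyPerfectInformation K q (λ n → log₂ (ℓ₀ n ⊔ 2))
  perfect r root = perfect-information K q (λ n → log₂ (ℓ₀ n ⊔ 2))
    -- The dominating sequence is the quotient that `_≪_[_]` sends to 0.
    (λ n → log₂ (ℓ₀ n ⊔ 2) * r n ⁻¹[ proj₁ (root n) ]) 0≤q 1≤logℓ
    (λ n → *-≤-quotient (q n) (log₂ (ℓ₀ n ⊔ 2)) (r n) (proj₁ (root n)) (0≤q n) (0≤logℓ n)
      (product-≤1 (q n) (r n) (dim n) (ℓ₀ n ⊔ 2) (0≤q n) (q^ℓ*dim≤½ n) (proj₂ (root n))))
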